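{- Let $\mathbb{F}_q$ be a finite field with $q$ elements, let $n\ge1$, and let $N_0,\dots,N_{n-1}$ be nonnegative integers with $0\le\sum_{i=0}^{n-1}N_i\le q-1$. Put $m=q^n-\sum_{i=0}^{n-1}N_iq^i$. Then $$\frac{H_{m-1}}{\Gamma_{m}|_{\theta=t}}=\frac{(-1)^{\sum_{i=0}^{n-2}(n-1-i)N_iq^i}}{\prod_{i=0}^{n-2}\bigl(L_{n-1-i}|_{\theta=t}\bigr)^{N_iq^i}}\;\prod_{i=1}^{n-1}(t-\theta^{q^i})^{\sum_{j=0}^{n-1-i}N_jq^j}.$$
   Context: $\theta,t$ are independent variables over $\mathbb{F}_q$, $A=\mathbb{F}_q[\theta]$. For $k\ge1$ put $[k]=\theta^{q^k}-\theta$, $L_k=[k][k-1]\cdots[1]$, $D_0=1$, $D_k=\prod_{i=0}^{k-1}(\theta^{q^k}-\theta^{q^i})$. For $n=\sum_i n_iq^i$ ($0\le n_i\le q-1$) put $\Gamma_{n+1}=\prod_i D_i^{n_i}\in A$. For a polynomial $f$ in $\theta$, $f|_{\theta=t}$ denotes substitution of $t$ for $\theta$. Put $G_0=1$ and $G_i=\prod_{j=1}^i(t^{q^i}-\theta^{q^j})$ for $i\ge1$. The Anderson–Thakur polynomials $H_n\in A[t]$ are defined by $\bigl(1-\sum_{i\ge0}\frac{G_i}{D_i|_{\theta=t}}x^{q^i}\bigr)^{ -1}=\sum_{n\ge0}\frac{H_n}{\Gamma_{n+1}|_{\theta=t}}x^n$. Empty sums are $0$ and empty products are $1$. -}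

module Defs where

open import Level using (Level; _⊔_) renaming (suc to lsuc)
open import Algebra.Bundles using (CommutativeRing)
open import Data.Nat using (ℕ; zero; suc; _∸_; _≤?_; NonZero; _/_; _%_)
  renaming (_+_ to _+ℕ_; _*_ to _*ℕ_; _^_ to _^ℕ_)
open import Data.Fin using (Fin)
open import Data.Product using (∃; _×_; _,_; proj₁; proj₂)
open import Relation.Nullary using (¬_; yes; no)
open import Relation.Binary.PropositionalEquality using (_≡_)

sumℕ : ℕ → (ℕ → ℕ) → ℕ
sumℕ zero    f = 0
sumℕ (suc n) f = sumℕ n f +ℕ f n

record FiniteField (c ℓ : Level) (q : ℕ) : Set (lsuc (c ⊔ ℓ)) where
  field
    commRing : CommutativeRing c ℓ
  open CommutativeRing commRing public hiding (ring)
  field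
    1≉0            : ¬ (1# ≈ 0#)
    inverse        : ∀ x → ¬ (x ≈ 0#) → ∃ λ y → x * y ≈ 1#
    enum           : Fin q → Carrier
    enum-injective : ∀ i j → enum i ≈ enum j → i ≡ j
    enum-surjective : ∀ x → ∃ λ i → enum i ≈ x

private
  fin⇒nz : ∀ {q} → Fin q → NonZero q
  fin⇒nz {suc k} _ = _

-- All objects of the paper, built inside the ring F_q[[θ,t]] of formal
-- power series in θ and t (which contains F_q[θ,t]); rational functions
-- are represented as fractions (numerator , denominator).
module Construction {c ℓ q} (𝔽 : FiniteField c ℓ q) where
  open FiniteField 𝔽

  instance
    q-nonZero : NonZero q
    q-nonZero = fin⇒nz (proj₁ (enum-surjective 0#))

  sumF : ℕ → (ℕ → Carrier) → Carrier
  sumF zero    f = 0#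
  sumF (suc n) f = sumF n f + f n

  -- Ser a b = coefficient of θ^a t^b
  Ser : Set c
  Ser = ℕ → ℕ → Carrier

  infix 4 _≋_
  _≋_ : Ser → Ser → Set ℓ
  f ≋ g = ∀ a b → f a b ≈ g a b

  const : Carrier → Ser
  const x zero zero = x
  const x _    _    = 0#

  0s 1s : Ser
  0s = const 0#
  1s = const 1#

  θ t : Ser
  θ (suc zero) zero = 1#
  θ _          _    = 0#
  t zero (suc zero) = 1#
  t _    _          = 0#

  infixl 6 _+s_ _-s_
  infixl 7 _*s_
  infixr 8 _^s_

  _+s_ : Ser → Ser → Ser
  (f +s g) a b = f a b + g a b

  -s_ : Ser → Ser
  (-s f) a b = - f a b

  _-s_ : Ser → Ser → Ser
  f -s g = f +s (-s g)

  _*s_ : Ser → Ser → Ser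
  (f *s g) a b = sumF (suc a) λ i → sumF (suc b) λ j → f i j * g (a ∸ i) (b ∸ j)

  _^s_ : Ser → ℕ → Ser
  f ^s zero  = 1s
  f ^s suc n = f *s (f ^s n)

  prodS : ℕ → (ℕ → Ser) → Ser
  prodS zero    f = 1s
  prodS (suc n) f = prodS n f *s f n

  -- Objects depending on the variable x (x = θ, or x = t for "|_{θ=t}")
  -- [k] = x^{q^k} - x
  brk : Ser → ℕ → Ser
  brk x k = x ^s (q ^ℕ k) -s x

  L : Ser → ℕ → Ser
  L x k = prodS k λ j → brk x (suc j)

  D : Ser → ℕ → Ser
  D x k = prodS k λ i → x ^s (q ^ℕ k) -s x ^s (q ^ℕ i)

  -- Π_{i ≥ k} D_i^{n_i} where n = Σ n_i q^{i-k}; fuel bounds the number of digits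
  gamDigits : Ser → (fuel level n : ℕ) → Ser
  gamDigits x zero     k n = 1s
  gamDigits x (suc f) k n = (D x k ^s (n % q)) *s gamDigits x f (suc k) (n / q)

  -- Γ₊₁ x n = Γ_{n+1} = Π_i D_i^{n_i}  (n has at most n base-q digits)
  Γ₊₁ : Ser → ℕ → Ser
  Γ₊₁ x n = gamDigits x n 0 n

  G : ℕ → Ser
  G i = prodS i λ j → t ^s (q ^ℕ i) -s θ ^s (q ^ℕ (suc j))

  Frac : Set c
  Frac = Ser × Ser

  infix 4 _≃_
  _≃_ : Frac → Frac → Set ℓ
  (a , b) ≃ (c' , d) = a *s d ≋ c' *s b

  infixl 6 _+f_
  infixl 7 _·f_ _÷_
  _+f_ : Frac → Frac → Frac
  (a , b) +f (c' , d) = (a *s d +s c' *s b , b *s d)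

  _·f_ : Frac → Frac → Frac
  (a , b) ·f (c' , d) = (a *s c' , b *s d)

  _÷_ : Frac → Frac → Frac
  (a , b) ÷ (c' , d) = (a *s d , b *s c')

  ⟦_⟧ : Ser → Frac
  ⟦ a ⟧ = (a , 1s)

  0f 1f : Frac
  0f = ⟦ 0s ⟧
  1f = ⟦ 1s ⟧

  sumFrac : ℕ → (ℕ → Frac) → Frac
  sumFrac zero    f = 0f
  sumFrac (suc n) f = sumFrac n f +f f n

  -- coefficient of x^{q^i} in Σ_i G_i / D_i|_{θ=t} x^{q^i}
  a : ℕ → Frac
  a i = (G i , D t i)

  -- coefficients of (1 - Σ_i a_i x^{q^i})^{-1}:
  --   c_0 = 1,   c_n = Σ_{i : q^i ≤ n} a_i c_{n - q^i}   (n ≥ 1);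
  -- computed with fuel (fuel > n suffices since q^i ≥ 1).
  cAux : (fuel n : ℕ) → Frac
  cAux zero    n       = 0f
  cAux (suc f) zero    = 1f
  cAux (suc f) (suc k) = sumFrac (suc (suc k)) λ i →
    term i (q ^ℕ i ≤? suc k)
    where
    term : ∀ i → _ → Frac
    term i (yes _) = a i ·f cAux f (suc k ∸ q ^ℕ i)
    term i (no _)  = 0f

  invCoeff : ℕ → Frac
  invCoeff n = cAux (suc n) n

  H : ℕ → Frac
  H n = ⟦ Γ₊₁ t n ⟧ ·f invCoeff n

{-# OPTIONS --safe #-}
-- Let e = Σ a_i x^{q^i} with a_i = G_i / D_i|_{θ=t}, so that H_{m-1} / Γ_m|_{θ=t} is the
-- coefficient of x^{m-1} in 1 / (1 - e).  Put t_k = t^{q^k}, θ_k = θ^{q^k},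
-- S_d = Π_{k=1}^d (t - θ_k) / (t - t_k) and l_d = S_d - S_{d-1}.  The sums
-- (t_n - t) Σ_{i≤r} l_i a_{n-i}^{q^i} telescope to a_{n-r}^{q^r} S_r (t_n - t_r), whence
-- x = Σ_j l_j e^{q^j}.  Write N = q^n - 1.  The coefficient of x^N in e^r vanishes unless
-- r = N: for r > N by order, and for r < N because e^r only involves exponents that are
-- sums of fewer than n (q - 1) powers of q.  Hence the coefficient of x^N in
-- e^k / (1 - e) is 1 for all k ≤ N, and that of p(e) / (1 - e) is p(1) for every
-- polynomial p of degree at most N.  Modulo x^{q^n}, the monomial Π_i x^{N_i q^i} equals
-- p(e) with p(z) = Π_i (Σ_{j<n-i} l_j z^{q^j})^{N_i q^i}, of degree at most
-- (q - 1) q^{n-1}, and p(1) = Π_i S_{n-1-i}^{N_i q^i}.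
-- The Frobenius x ↦ x^q is additive since (b + 1)^q - b^q - 1, a polynomial of degree
-- less than q, vanishes at all q elements b of the field.
module Submission where

open import Defs
open import Level using (_⊔_)
open import Algebra.Bundles using (RawRing; CommutativeMonoid; CommutativeRing)
open import Algebra.Morphism.Structures using (IsRingMonomorphism)
import Algebra.Morphism.RingMonomorphism as RingMonomorphism
import Algebra.Properties.AbelianGroup as AbelianGroupProperties
import Algebra.Properties.CommutativeMonoid.Sum as CommutativeMonoidSum
import Algebra.Properties.CommutativeSemigroup as CommutativeSemigroupProperties
import Algebra.Properties.CommutativeSemiring.Binomial as Binomial
import Algebra.Properties.CommutativeSemiring.Exp as Exp
import Algebra.Properties.Group as GroupProperties
import Algebra.Properties.Ring as RingProperties
import Algebra.Properties.Semiring.Mult as Mult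
import Algebra.Properties.Semiring.Sum as SemiringSum
import Algebra.Solver.Ring.NaturalCoefficients.Default as SemiringSolver
open import Data.Empty using (⊥-elim)
open import Data.Fin.Base using (Fin; zero; suc; toℕ; fromℕ; fromℕ<; inject₁)
open import Data.Fin.Permutation using (permutation)
import Data.Fin.Properties as Fin
open import Data.Nat.Base as ℕ using (ℕ; zero; suc; _∸_; _≤_; _<_; z≤n; s≤s)
open import Data.Nat.Combinatorics using (_C_; nCn≡1; nCk≡nC[n∸k])
import Data.Nat.DivMod as ℕ
import Data.Nat.Properties as ℕ
open import Data.Nat.Solver using (module +-*-Solver)
open import Data.Product.Base using (_,_; proj₁; proj₂; ∃; ∃₂; Σ-syntax)
open import Data.Sum.Base using (_⊎_; inj₁; inj₂)
open import Data.Vec.Base using (Vec; []; _∷_; tabulate)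
open import Data.Vec.Relation.Unary.All using (All; []; _∷_)
open import Data.Vec.Relation.Unary.All.Properties using (tabulate⁻)
open import Function.Base using (id; _∘_)
open import Relation.Binary.Definitions using (tri<; tri≈; tri>)
open import Relation.Binary.PropositionalEquality as ≡ using (_≡_; _≢_)
import Relation.Binary.Reasoning.Setoid as SetoidReasoning
open import Relation.Nullary using (¬_; Dec; yes; no)

-- Big operators and formal power series

-- In the statement a fraction is a bare pair of series and `≃` is cross-multiplication, which is
-- transitive only if denominators can be cancelled. The argument therefore runs in the total ring
-- of fractions of F_q[[θ,t]], and `Represents` ties bare pairs to its elements. The denominators
-- are built from the differences `t^(q^k) - t`, which are regular because their lowest term in `t`
-- is `-t`. Identities between series are needed only modulo `X^(q^n)`. Hence `e` is cut after `n`
-- terms, and `1 / (1 - e)` becomes the finite sum of the `e^r` with `r ≤ q^n - 1`. The `l_d` are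
-- the coefficients of the compositional inverse of `e`, a logarithm. Since Frobenius is additive,
-- `e^(q^i)` is again supported on powers of `q`; writing `r` in base `q` shows that each exponent
-- in `e^r` is a sum of at most as many powers of `q` as the digit sum of `r`. Below `q^n - 1` this
-- digit sum stays under `n (q - 1)`. The bound on the sum of the `N_i` gives `p` a degree of at
-- most `(q - 1) q^(n-1) ≤ q^n - 1`, within the range where the coefficient of `e^k / (1 - e)` is 1.

module BigOperator {c ℓ} (M : CommutativeMonoid c ℓ) where
  open CommutativeMonoid M
  open CommutativeSemigroupProperties commutativeSemigroup using (interchange)
  open SetoidReasoning setoid

  fold : ℕ → (ℕ → Carrier) → Carrier
  fold zero    f = ε
  fold (suc n) f = fold n f ∙ f n

  fold-cong : ∀ n {f g} → (∀ i → i < n → f i ≈ g i) → fold n f ≈ fold n g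
  fold-cong zero    f≈g = refl
  fold-cong (suc n) f≈g =
    ∙-cong (fold-cong n λ i i<n → f≈g i (ℕ.m<n⇒m<1+n i<n)) (f≈g n ℕ.≤-refl)

  fold-ε : ∀ n {f} → (∀ i → i < n → f i ≈ ε) → fold n f ≈ ε
  fold-ε zero    f≈ε = refl
  fold-ε (suc n) f≈ε = trans
    (∙-cong (fold-ε n λ i i<n → f≈ε i (ℕ.m<n⇒m<1+n i<n)) (f≈ε n ℕ.≤-refl))
    (identityˡ ε)

  fold-∙ : ∀ n f g → fold n (λ i → f i ∙ g i) ≈ fold n f ∙ fold n g
  fold-∙ zero    f g = sym (identityˡ ε)
  fold-∙ (suc n) f g = trans (∙-congʳ (fold-∙ n f g)) (interchange _ _ _ _)

  fold-split-first : ∀ n f → fold (suc n) f ≈ f 0 ∙ fold n (f ∘ suc)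
  fold-split-first zero    f = comm _ _
  fold-split-first (suc n) f = trans (∙-congʳ (fold-split-first n f)) (assoc _ _ _)

  fold-extend : ∀ m k f → (∀ i → m ≤ i → f i ≈ ε) → fold (m ℕ.+ k) f ≈ fold m f
  fold-extend m zero    f f≈ε = reflexive (≡.cong (λ j → fold j f) (ℕ.+-identityʳ m))
  fold-extend m (suc k) f f≈ε = begin
    fold (m ℕ.+ suc k) f               ≡⟨ ≡.cong (λ j → fold j f) (ℕ.+-suc m k) ⟩
    fold (m ℕ.+ k) f ∙ f (m ℕ.+ k)     ≈⟨ ∙-cong (fold-extend m k f f≈ε) (f≈ε _ (ℕ.m≤m+n m k)) ⟩
    fold m f ∙ ε                       ≈⟨ identityʳ _ ⟩
    fold m f                           ∎

  fold-truncate : ∀ {m n} f → m ≤ n → (∀ i → m ≤ i → f i ≈ ε) → fold n f ≈ fold m f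
  fold-truncate {m} {n} f m≤n f≈ε = trans
    (reflexive (≡.cong (λ j → fold j f) (≡.sym (ℕ.m+[n∸m]≡n m≤n))))
    (fold-extend m (n ∸ m) f f≈ε)

  fold-single : ∀ n f {k} → k < n → (∀ i → i < n → i ≢ k → f i ≈ ε) → fold n f ≈ f k
  fold-single (suc n) f {k} k<1+n f≈ε with ℕ.m≤n⇒m<n∨m≡n (ℕ.s≤s⁻¹ k<1+n)
  ... | inj₁ k<n = trans
    (∙-cong (fold-single n f k<n λ i i<n → f≈ε i (ℕ.m<n⇒m<1+n i<n)) (f≈ε n ℕ.≤-refl (ℕ.>⇒≢ k<n)))
    (identityʳ _)
  ... | inj₂ ≡.refl = trans
    (∙-congʳ (fold-ε n λ i i<n → f≈ε i (ℕ.m<n⇒m<1+n i<n) (ℕ.<⇒≢ i<n)))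
    (identityˡ _)

  -- Both sides run over the pairs with `j + k < d`, on the right grouped by `s = j + k`. Passing
  -- from `d` to `suc d` adds the antidiagonal `j + k = d` to each.
  fold-antidiagonal : ∀ d (f : ℕ → ℕ → Carrier) →
    fold d (λ j → fold (d ∸ j) (f j)) ≈ fold d (λ s → fold (suc s) (λ j → f j (s ∸ j)))
  fold-antidiagonal zero    f = refl
  fold-antidiagonal (suc d) f = begin
    fold d (λ j → fold (suc d ∸ j) (f j)) ∙ fold (suc d ∸ d) (f d)
      ≈⟨ ∙-cong (fold-cong d λ j j<d → reflexive (≡.cong (λ m → fold m (f j)) (ℕ.+-∸-assoc 1 (ℕ.<⇒≤ j<d)))) last ⟩
    fold d (λ j → fold (d ∸ j) (f j) ∙ f j (d ∸ j)) ∙ f d (d ∸ d)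
      ≈⟨ ∙-congʳ (fold-∙ d _ _) ⟩
    (fold d (λ j → fold (d ∸ j) (f j)) ∙ fold d (λ j → f j (d ∸ j))) ∙ f d (d ∸ d)
      ≈⟨ assoc _ _ _ ⟩
    fold d (λ j → fold (d ∸ j) (f j)) ∙ fold (suc d) (λ j → f j (d ∸ j))
      ≈⟨ ∙-congʳ (fold-antidiagonal d f) ⟩
    fold d (λ s → fold (suc s) (λ j → f j (s ∸ j))) ∙ fold (suc d) (λ j → f j (d ∸ j)) ∎
    where
    last : fold (suc d ∸ d) (f d) ≈ f d (d ∸ d)
    last = begin
      fold (suc d ∸ d) (f d) ≡⟨ ≡.cong (λ m → fold m (f d)) (ℕ.m+n∸n≡m 1 d) ⟩
      ε ∙ f d 0              ≈⟨ identityˡ _ ⟩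
      f d 0                  ≡⟨ ≡.cong (f d) (≡.sym (ℕ.n∸n≡0 d)) ⟩
      f d (d ∸ d)            ∎

  -- Both sides run over the pairs with `i + k < d`. Row 0 is split off; it supplies the top entry
  -- of every column.
  fold-triangle-swap : ∀ d (f : ℕ → ℕ → Carrier) →
    fold d (λ i → fold (d ∸ i) (λ k → f i k)) ≈ fold d (λ k → fold (d ∸ k) (λ i → f i k))
  fold-triangle-swap zero    f = refl
  fold-triangle-swap (suc d) f = begin
    fold (suc d) (λ i → fold (suc d ∸ i) (f i))
      ≈⟨ fold-split-first d _ ⟩
    fold (suc d) (f 0) ∙ fold d (λ i → fold (d ∸ i) (f (suc i)))
      ≈⟨ ∙-congˡ (fold-triangle-swap d (f ∘ suc)) ⟩
    fold (suc d) (f 0) ∙ fold d (λ k → fold (d ∸ k) (λ i → f (suc i) k))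
      -- An empty column `k = d` is appended, so that both outer folds have length `suc d` and can
      -- be merged.
      ≈⟨ ∙-congˡ (identityʳ _) ⟨
    fold (suc d) (f 0) ∙ (fold d (λ k → fold (d ∸ k) (λ i → f (suc i) k)) ∙ ε)
      ≡⟨ ≡.cong (λ m → fold (suc d) (f 0) ∙ (fold d (λ k → fold (d ∸ k) (λ i → f (suc i) k)) ∙ fold m (λ i → f (suc i) d)))
               (≡.sym (ℕ.n∸n≡0 d)) ⟩
    fold (suc d) (f 0) ∙ fold (suc d) (λ k → fold (d ∸ k) (λ i → f (suc i) k))
      ≈⟨ fold-∙ (suc d) _ _ ⟨
    fold (suc d) (λ k → f 0 k ∙ fold (d ∸ k) (λ i → f (suc i) k))
      ≈⟨ fold-cong (suc d) (λ k k<1+d → column k (ℕ.s≤s⁻¹ k<1+d)) ⟨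
    fold (suc d) (λ k → fold (suc d ∸ k) (λ i → f i k)) ∎
    where
    column : ∀ k → k ≤ d →
      fold (suc d ∸ k) (λ i → f i k) ≈ f 0 k ∙ fold (d ∸ k) (λ i → f (suc i) k)
    column k k≤d = trans
      (reflexive (≡.cong (λ m → fold m (λ i → f i k)) (ℕ.+-∸-assoc 1 k≤d)))
      (fold-split-first (d ∸ k) (λ i → f i k))

module PowerSeries {c ℓ} (R : CommutativeRing c ℓ) where
  open CommutativeRing R
  open CommutativeSemigroupProperties +-commutativeSemigroup using (interchange; x∙yz≈y∙xz)
  open SetoidReasoning setoid
  open BigOperator +-commutativeMonoid using () renaming (fold to ∑; fold-split-first to ∑-split-first)

  Series : Set c
  Series = ℕ → Carrier

  infix 4 _≋_
  _≋_ : Series → Series → Set ℓ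
  f ≋ g = ∀ n → f n ≈ g n

  infixl 6 _⊕_
  _⊕_ : Series → Series → Series
  (f ⊕ g) n = f n + g n

  ⊖_ : Series → Series
  (⊖ f) n = - f n

  𝟘 𝟙 : Series
  𝟘 _       = 0#
  𝟙 zero    = 1#
  𝟙 (suc _) = 0#

  infixl 7 _⊛_
  -- The Cauchy product, by recursion along `f = f 0 + X (f ∘ suc)`. In this form the ring laws
  -- follow by induction on the index; `⊛-as-sum` recovers the usual convolution.
  _⊛_ : Series → Series → Series
  (f ⊛ g) zero    = f 0 * g 0
  (f ⊛ g) (suc n) = f 0 * g (suc n) + ((f ∘ suc) ⊛ g) n

  ⊛-cong : ∀ {f f′ g g′} → f ≋ f′ → g ≋ g′ → f ⊛ g ≋ f′ ⊛ g′
  ⊛-cong f≈ g≈ zero    = *-cong (f≈ 0) (g≈ 0)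
  ⊛-cong f≈ g≈ (suc n) = +-cong (*-cong (f≈ 0) (g≈ (suc n))) (⊛-cong (f≈ ∘ suc) g≈ n)

  ⊛-split-last : ∀ f g n → (f ⊛ g) (suc n) ≈ f (suc n) * g 0 + (f ⊛ (g ∘ suc)) n
  ⊛-split-last f g zero    = +-comm _ _
  ⊛-split-last f g (suc n) = trans (+-congˡ (⊛-split-last (f ∘ suc) g n)) (x∙yz≈y∙xz _ _ _)

  ⊛-comm : ∀ f g → f ⊛ g ≋ g ⊛ f
  ⊛-comm f g zero    = *-comm _ _
  ⊛-comm f g (suc n) =
    trans (⊛-split-last f g n) (+-cong (*-comm _ _) (⊛-comm f (g ∘ suc) n))

  ⊛-distribʳ : ∀ h f g → (f ⊕ g) ⊛ h ≋ f ⊛ h ⊕ g ⊛ h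
  ⊛-distribʳ h f g zero    = distribʳ _ _ _
  ⊛-distribʳ h f g (suc n) =
    trans (+-cong (distribʳ _ _ _) (⊛-distribʳ h (f ∘ suc) (g ∘ suc) n)) (interchange _ _ _ _)

  ⊛-distribˡ : ∀ h f g → h ⊛ (f ⊕ g) ≋ h ⊛ f ⊕ h ⊛ g
  ⊛-distribˡ h f g n = begin
    (h ⊛ (f ⊕ g)) n     ≈⟨ ⊛-comm h (f ⊕ g) n ⟩
    ((f ⊕ g) ⊛ h) n     ≈⟨ ⊛-distribʳ h f g n ⟩
    (f ⊛ h ⊕ g ⊛ h) n   ≈⟨ +-cong (⊛-comm f h n) (⊛-comm g h n) ⟩
    (h ⊛ f ⊕ h ⊛ g) n   ∎

  ⊛-scaleˡ : ∀ x f g n → ((λ i → x * f i) ⊛ g) n ≈ x * (f ⊛ g) n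
  ⊛-scaleˡ x f g zero    = *-assoc _ _ _
  ⊛-scaleˡ x f g (suc n) =
    trans (+-cong (*-assoc _ _ _) (⊛-scaleˡ x (f ∘ suc) g n)) (sym (distribˡ _ _ _))

  ⊛-assoc : ∀ f g h → (f ⊛ g) ⊛ h ≋ f ⊛ (g ⊛ h)
  ⊛-assoc f g h zero    = *-assoc _ _ _
  ⊛-assoc f g h (suc n) = begin
    f 0 * g 0 * h (suc n) + (((λ i → f 0 * g (suc i)) ⊕ (f ∘ suc) ⊛ g) ⊛ h) n
      ≈⟨ +-cong (*-assoc _ _ _) (⊛-distribʳ h _ _ n) ⟩
    f 0 * (g 0 * h (suc n)) + (((λ i → f 0 * g (suc i)) ⊛ h) n + (((f ∘ suc) ⊛ g) ⊛ h) n)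
      ≈⟨ +-congˡ (+-cong (⊛-scaleˡ (f 0) (g ∘ suc) h n) (⊛-assoc (f ∘ suc) g h n)) ⟩
    f 0 * (g 0 * h (suc n)) + (f 0 * ((g ∘ suc) ⊛ h) n + ((f ∘ suc) ⊛ (g ⊛ h)) n)
      ≈⟨ +-assoc _ _ _ ⟨
    f 0 * (g 0 * h (suc n)) + f 0 * ((g ∘ suc) ⊛ h) n + ((f ∘ suc) ⊛ (g ⊛ h)) n
      ≈⟨ +-congʳ (distribˡ _ _ _) ⟨
    f 0 * (g ⊛ h) (suc n) + ((f ∘ suc) ⊛ (g ⊛ h)) n ∎

  ⊛-zeroˡ : ∀ f → 𝟘 ⊛ f ≋ 𝟘
  ⊛-zeroˡ f zero    = zeroˡ _
  ⊛-zeroˡ f (suc n) = trans (+-cong (zeroˡ _) (⊛-zeroˡ f n)) (+-identityˡ _)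

  ⊛-identityˡ : ∀ f → 𝟙 ⊛ f ≋ f
  ⊛-identityˡ f zero    = *-identityˡ _
  ⊛-identityˡ f (suc n) = trans (+-cong (*-identityˡ _) (⊛-zeroˡ f n)) (+-identityʳ _)

  ⊛-as-sum : ∀ f g n → (f ⊛ g) n ≈ ∑ (suc n) (λ i → f i * g (n ∸ i))
  ⊛-as-sum f g zero    = sym (+-identityˡ _)
  ⊛-as-sum f g (suc n) =
    trans (+-congˡ (⊛-as-sum (f ∘ suc) g n)) (sym (∑-split-first (suc n) _))

  seriesRing : CommutativeRing c ℓ
  seriesRing = record
    { Carrier = Series ; _≈_ = _≋_ ; _+_ = _⊕_ ; _*_ = _⊛_ ; -_ = ⊖_ ; 0# = 𝟘 ; 1# = 𝟙
    ; isCommutativeRing = record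
      { isRing = record
        { +-isAbelianGroup = record
          { isGroup = record
            { isMonoid = record
              { isSemigroup = record
                { isMagma = record
                  { isEquivalence = record
                    { refl = λ _ → refl ; sym = λ p n → sym (p n) ; trans = λ p r n → trans (p n) (r n) }
                  ; ∙-cong = λ p r n → +-cong (p n) (r n) }
                ; assoc = λ f g h n → +-assoc _ _ _ }
              ; identity = (λ f n → +-identityˡ _) , (λ f n → +-identityʳ _) }
            ; inverse = (λ f n → -‿inverseˡ _) , (λ f n → -‿inverseʳ _)
            ; ⁻¹-cong = λ p n → -‿cong (p n) }
          ; comm = λ f g n → +-comm _ _ }
        ; *-cong = λ {f} {f′} {g} {g′} → ⊛-cong {f} {f′} {g} {g′}
        ; *-assoc = ⊛-assoc
        ; *-identity = ⊛-identityˡ , λ f n → trans (⊛-comm f 𝟙 n) (⊛-identityˡ f n)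
        ; distrib = ⊛-distribˡ , ⊛-distribʳ }
      ; *-comm = ⊛-comm } }

-- Total ring of fractions

module Fractions {c ℓ} (R : CommutativeRing c ℓ) where
  open CommutativeRing R
  open GroupProperties +-group using (x∙y⁻¹≈ε⇒x≈y; x≈y⇒x∙y⁻¹≈ε)
  open RingProperties ring using (-‿distribˡ-*)
  open SetoidReasoning setoid
  private module Solver = SemiringSolver commutativeSemiring
  open Solver using (solve; _:*_; _:+_; _:=_; con)

  Regular : Carrier → Set (c ⊔ ℓ)
  Regular d = ∀ x → x * d ≈ 0# → x ≈ 0#

  regular-cancel : ∀ {d x y} → Regular d → x * d ≈ y * d → x ≈ y
  regular-cancel {d} {x} {y} r xd≈yd = x∙y⁻¹≈ε⇒x≈y x y (r (x - y) (begin
    (x - y) * d          ≈⟨ distribʳ d x (- y) ⟩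
    x * d + - y * d      ≈⟨ +-congˡ (-‿distribˡ-* y d) ⟨
    x * d - y * d        ≈⟨ x≈y⇒x∙y⁻¹≈ε xd≈yd ⟩
    0#                   ∎))

  abstract
    regular-1 : Regular 1#
    regular-1 x x1≈0 = trans (sym (*-identityʳ x)) x1≈0

    regular-* : ∀ {d e} → Regular d → Regular e → Regular (d * e)
    regular-* rd re x xde≈0 = rd x (re _ (trans (*-assoc _ _ _) xde≈0))

  -- Each fraction carries the proof that its denominator is no zero divisor, which is what makes
  -- cross-multiplication an equivalence.
  record Fraction : Set (c ⊔ ℓ) where
    constructor mk
    field
      num     : Carrier
      den     : Carrier
      regular : Regular den
  open Fraction public

  infix 4 _≃_
  -- A record rather than a synonym for the cross-multiplied equation, so that both fractions can be
  -- inferred from a proof of their equality.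
  record _≃_ (x y : Fraction) : Set ℓ where
    constructor by
    field
      cross : num x * den y ≈ num y * den x
  open _≃_ public

  infixl 6 _⊕_
  infixl 7 _⊛_
  _⊕_ _⊛_ : Fraction → Fraction → Fraction
  x ⊕ y = mk (num x * den y + num y * den x) (den x * den y) (regular-* (regular x) (regular y))
  x ⊛ y = mk (num x * num y) (den x * den y) (regular-* (regular x) (regular y))

  ⊖_ : Fraction → Fraction
  ⊖ x = mk (- num x) (den x) (regular x)

  embed : Carrier → Fraction
  embed x = mk x 1# regular-1

  -- The two equations give the desired one multiplied by the middle denominator `d`, and regularity
  -- cancels `d`.
  ≃-trans : ∀ {x y z} → x ≃ y → y ≃ z → x ≃ z
  ≃-trans {mk a b _} {mk c d rd} {mk e f _} (by ad≈cb) (by cf≈ed) = by (regular-cancel rd (begin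
    a * f * d   ≈⟨ solve 3 (λ a f d → a :* f :* d := a :* d :* f) refl a f d ⟩
    a * d * f   ≈⟨ *-congʳ ad≈cb ⟩
    c * b * f   ≈⟨ solve 3 (λ c b f → c :* b :* f := c :* f :* b) refl c b f ⟩
    c * f * b   ≈⟨ *-congʳ cf≈ed ⟩
    e * d * b   ≈⟨ solve 3 (λ e d b → e :* d :* b := e :* b :* d) refl e d b ⟩
    e * b * d   ∎))

  ⊕-cong : ∀ {x x′ y y′} → x ≃ x′ → y ≃ y′ → x ⊕ y ≃ x′ ⊕ y′
  ⊕-cong {mk a b _} {mk a′ b′ _} {mk c d _} {mk c′ d′ _} (by p) (by r) = by (begin
    (a * d + c * b) * (b′ * d′)
      ≈⟨ solve 6 (λ a d c b b′ d′ → (a :* d :+ c :* b) :* (b′ :* d′)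
                 := a :* b′ :* (d :* d′) :+ c :* d′ :* (b :* b′)) refl a d c b b′ d′ ⟩
    a * b′ * (d * d′) + c * d′ * (b * b′)
      ≈⟨ +-cong (*-congʳ p) (*-congʳ r) ⟩
    a′ * b * (d * d′) + c′ * d * (b * b′)
      ≈⟨ solve 6 (λ a d c b b′ d′ → a :* b :* (d :* d′) :+ c :* d :* (b :* b′)
                 := (a :* d′ :+ c :* b′) :* (b :* d)) refl a′ d c′ b b′ d′ ⟩
    (a′ * d′ + c′ * b′) * (b * d) ∎)

  ⊛-cong : ∀ {x x′ y y′} → x ≃ x′ → y ≃ y′ → x ⊛ y ≃ x′ ⊛ y′
  ⊛-cong {mk a b _} {mk a′ b′ _} {mk c d _} {mk c′ d′ _} (by p) (by r) = by (begin
    a * c * (b′ * d′)    ≈⟨ solve 4 (λ a c b d → a :* c :* (b :* d) := a :* b :* (c :* d)) refl a c b′ d′ ⟩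
    a * b′ * (c * d′)    ≈⟨ *-cong p r ⟩
    a′ * b * (c′ * d)    ≈⟨ solve 4 (λ a c b d → a :* b :* (c :* d) := a :* c :* (b :* d)) refl a′ c′ b d ⟩
    a′ * c′ * (b * d)    ∎)

  ⊖-cong : ∀ {x y} → x ≃ y → ⊖ x ≃ ⊖ y
  ⊖-cong {mk a b _} {mk c d _} (by p) = by (begin
    - a * d     ≈⟨ -‿distribˡ-* a d ⟨
    - (a * d)   ≈⟨ -‿cong p ⟩
    - (c * b)   ≈⟨ -‿distribˡ-* c b ⟩
    - c * b     ∎)

  ⊖-inverseˡ : ∀ x → ⊖ x ⊕ x ≃ embed 0#
  ⊖-inverseˡ (mk a b _) = by (begin
    (- a * b + a * b) * 1#   ≈⟨ *-identityʳ _ ⟩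
    - a * b + a * b          ≈⟨ distribʳ b (- a) a ⟨
    (- a + a) * b            ≈⟨ *-congʳ (-‿inverseˡ a) ⟩
    0# * b                   ≈⟨ zeroˡ b ⟩
    0#                       ≈⟨ zeroˡ _ ⟨
    0# * (b * b)             ∎)

  ⊕-comm : ∀ x y → x ⊕ y ≃ y ⊕ x
  ⊕-comm (mk a b _) (mk c d _) =
    by (solve 4 (λ a b c d → (a :* d :+ c :* b) :* (d :* b) := (c :* b :+ a :* d) :* (b :* d)) refl a b c d)

  ⊛-comm : ∀ x y → x ⊛ y ≃ y ⊛ x
  ⊛-comm (mk a b _) (mk c d _) =
    by (solve 4 (λ a b c d → a :* c :* (d :* b) := c :* a :* (b :* d)) refl a b c d)

  ⊕-identityˡ : ∀ x → embed 0# ⊕ x ≃ x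
  ⊕-identityˡ (mk a b _) =
    by (solve 2 (λ a b → (con 0 :* b :+ a :* con 1) :* b := a :* (con 1 :* b)) refl a b)

  ⊛-identityˡ : ∀ x → embed 1# ⊛ x ≃ x
  ⊛-identityˡ (mk a b _) = by (solve 2 (λ a b → con 1 :* a :* b := a :* (con 1 :* b)) refl a b)

  ⊛-distribʳ : ∀ z x y → (x ⊕ y) ⊛ z ≃ x ⊛ z ⊕ y ⊛ z
  ⊛-distribʳ (mk e f _) (mk a b _) (mk c d _) =
    by (solve 6 (λ a b c d e f → (a :* d :+ c :* b) :* e :* (b :* f :* (d :* f))
             := (a :* e :* (d :* f) :+ c :* e :* (b :* f)) :* (b :* d :* f)) refl a b c d e f)

  fractionRing : CommutativeRing (c ⊔ ℓ) ℓ
  fractionRing = record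
    { Carrier = Fraction ; _≈_ = _≃_ ; _+_ = _⊕_ ; _*_ = _⊛_ ; -_ = ⊖_
    ; 0# = embed 0# ; 1# = embed 1#
    ; isCommutativeRing = record
      { isRing = record
        { +-isAbelianGroup = record
          { isGroup = record
            { isMonoid = record
              { isSemigroup = record
                { isMagma = record
                  { isEquivalence = record
                    { refl = by refl ; sym = λ (by p) → by (sym p) ; trans = ≃-trans }
                  ; ∙-cong = ⊕-cong }
                ; assoc = λ { (mk a b _) (mk c d _) (mk e f _) →
                    by (solve 6 (λ a b c d e f →
                      ((a :* d :+ c :* b) :* f :+ e :* (b :* d)) :* (b :* (d :* f))
                      := (a :* (d :* f) :+ (c :* f :+ e :* d) :* b) :* (b :* d :* f)) refl a b c d e f) } }
              ; identity = ⊕-identityˡ , λ x →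
                  ≃-trans (⊕-comm x (embed 0#)) (⊕-identityˡ x) }
            ; inverse = ⊖-inverseˡ , λ x →
                ≃-trans (⊕-comm x (⊖ x)) (⊖-inverseˡ x)
            ; ⁻¹-cong = ⊖-cong }
          ; comm = ⊕-comm }
        ; *-cong = ⊛-cong
        ; *-assoc = λ { (mk a b _) (mk c d _) (mk e f _) →
            by (solve 6 (λ a b c d e f → a :* c :* e :* (b :* (d :* f)) := a :* (c :* e) :* (b :* d :* f)) refl a b c d e f) }
        ; *-identity = ⊛-identityˡ , λ x →
            ≃-trans (⊛-comm x (embed 1#)) (⊛-identityˡ x)
        ; distrib = (λ z x y → ≃-trans (⊛-comm z (x ⊕ y))
                      (≃-trans (⊛-distribʳ z x y)
                        (⊕-cong (⊛-comm x z) (⊛-comm y z))))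
                  , ⊛-distribʳ }
      ; *-comm = ⊛-comm } }

  private module K = CommutativeRing fractionRing
  open Exp commutativeSemiring using (_^_)
  open Exp K.commutativeSemiring using () renaming (_^_ to _^ₖ_)
  open BigOperator *-commutativeMonoid using () renaming (fold to ∏)
  open BigOperator K.*-commutativeMonoid using () renaming (fold to ∏ₖ)

  regular-≈ : ∀ {d e} → d ≈ e → Regular d → Regular e
  regular-≈ d≈e r x xe≈0 = r x (trans (*-congˡ d≈e) xe≈0)

  regular-^ : ∀ {d} m → Regular d → Regular (d ^ m)
  regular-^ ℕ.zero    r = regular-1
  regular-^ (ℕ.suc m) r = regular-* r (regular-^ m r)

  regular-∏ : ∀ n {f : ℕ → Carrier} → (∀ i → Regular (f i)) → Regular (∏ n f)
  regular-∏ ℕ.zero    r = regular-1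
  regular-∏ (ℕ.suc n) r = regular-* (regular-∏ n r) (r n)

  mk-^ : ∀ {u v} (r : Regular v) m → mk u v r ^ₖ m ≃ mk (u ^ m) (v ^ m) (regular-^ m r)
  mk-^ r ℕ.zero    = by refl
  mk-^ r (ℕ.suc m) = by (cross (⊛-cong (K.refl {mk _ _ r}) (mk-^ r m)))

  mk-∏ : ∀ n {u v : ℕ → Carrier} (r : ∀ i → Regular (v i)) →
    ∏ₖ n (λ i → mk (u i) (v i) (r i)) ≃ mk (∏ n u) (∏ n v) (regular-∏ n r)
  mk-∏ ℕ.zero    r = by refl
  mk-∏ (ℕ.suc n) r = by (cross (⊛-cong (mk-∏ n r) (K.refl {mk _ _ (r n)})))

  embed-+ : ∀ x y → embed x ⊕ embed y ≃ embed (x + y)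
  embed-+ x y = by (*-cong (+-cong (*-identityʳ x) (*-identityʳ y)) (sym (*-identityʳ 1#)))

  embed-cong : ∀ {x y} → x ≈ y → embed x ≃ embed y
  embed-cong x≈y = by (*-congʳ x≈y)

  embed-* : ∀ x y → embed x ⊛ embed y ≃ embed (x * y)
  embed-* x y = by (*-congˡ (sym (*-identityʳ 1#)))

  embed-^ : ∀ x m → embed x ^ₖ m ≃ embed (x ^ m)
  embed-^ x ℕ.zero    = by refl
  embed-^ x (ℕ.suc m) = ≃-trans (⊛-cong (K.refl {embed x}) (embed-^ x m)) (embed-* x (x ^ m))

-- Finite fields

module BinomialSplit {c ℓ} (R : CommutativeRing c ℓ) where
  open CommutativeRing R hiding (zero)
  open Exp commutativeSemiring using (_^_)
  open Mult semiring using (_×_; ×-congˡ; ×-homo-1)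
  open CommutativeMonoidSum +-commutativeMonoid using (sum; sum-cong-≋; sum-init-last)
  open SetoidReasoning setoid

  -- The two end terms are separated because the binomial coefficients to be shown zero later are
  -- those strictly between them.
  binomial-split : ∀ k x y → (x + y) ^ suc k ≈
    y ^ suc k + (sum {k} (λ i → (suc k C suc (toℕ i)) × (x ^ suc (toℕ i) * y ^ (k ∸ toℕ i))) + x ^ suc k)
  binomial-split k x y = begin
    (x + y) ^ suc k                           ≈⟨ Binomial.theorem commutativeSemiring (suc k) x y ⟩
    term zero + sum {suc k} (term ∘ suc)            ≈⟨ +-cong first (sum-init-last (term ∘ suc)) ⟩
    y ^ suc k + (sum {k} (term ∘ suc ∘ inject₁) + term (fromℕ (suc k)))
      ≈⟨ +-congˡ (+-cong (sum-cong-≋ middle) last) ⟩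
    _ ∎
    where
    term : Fin (suc (suc k)) → Carrier
    term i = (suc k C toℕ i) × (x ^ toℕ i * y ^ (suc k ∸ toℕ i))

    first : term zero ≈ y ^ suc k
    first = begin
      term zero               ≈⟨ ×-congˡ (≡.trans (nCk≡nC[n∸k] {0} {suc k} z≤n) (nCn≡1 (suc k))) ⟩
      1 × (1# * y ^ suc k)    ≈⟨ ×-homo-1 _ ⟩
      1# * y ^ suc k          ≈⟨ *-identityˡ _ ⟩
      y ^ suc k               ∎

    middle : ∀ i → term (suc (inject₁ i)) ≈ (suc k C suc (toℕ i)) × (x ^ suc (toℕ i) * y ^ (k ∸ toℕ i))
    middle i = reflexive (≡.cong (λ j → (suc k C suc j) × (x ^ suc j * y ^ (k ∸ j))) (Fin.toℕ-inject₁ i))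

    last : term (fromℕ (suc k)) ≈ x ^ suc k
    last = begin
      term (fromℕ (suc k))
        ≡⟨ ≡.cong (λ j → (suc k C j) × (x ^ j * y ^ (suc k ∸ j))) (Fin.toℕ-fromℕ (suc k)) ⟩
      (suc k C suc k) × (x ^ suc k * y ^ (k ∸ k))
        ≡⟨ ≡.cong₂ (λ u v → u × (x ^ suc k * y ^ v)) (nCn≡1 (suc k)) (ℕ.n∸n≡0 k) ⟩
      1 × (x ^ suc k * 1#)    ≈⟨ ×-homo-1 _ ⟩
      x ^ suc k * 1#          ≈⟨ *-identityʳ _ ⟩
      x ^ suc k               ∎

module FiniteFieldProperties {c ℓ q} (𝔽 : FiniteField c ℓ q) where
  open FiniteField 𝔽 hiding (zero)
  open Exp commutativeSemiring using (_^_; ^-congˡ)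
  open Mult semiring using (_×_; ×-congʳ; ×-assoc-*)
  open CommutativeMonoidSum *-commutativeMonoid
    using () renaming (sum to prod; sum-cong-≋ to prod-cong; sum-permute to prod-permute;
                       ∑-distrib-+ to prod-distrib-*; sum-replicate to prod-replicate)
  open CommutativeMonoidSum +-commutativeMonoid using (sum; sum-cong-≋)
  open SemiringSum semiring using (*-distribˡ-sum)
  open CommutativeSemigroupProperties *-commutativeSemigroup using (x∙yz≈y∙xz)
  open GroupProperties +-group using (x∙y⁻¹≈ε⇒x≈y; x≈y⇒x∙y⁻¹≈ε; ∙-cancelˡ; ∙-cancelʳ)
  open RingProperties (CommutativeRing.ring commRing) using (-‿distribˡ-*)
  open SetoidReasoning setoid
  private module Solver = SemiringSolver commutativeSemiring
  open Solver using (solve; _:*_; _:+_; _:=_; con)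

  index : Carrier → Fin q
  index x = proj₁ (enum-surjective x)

  enum-index : ∀ x → enum (index x) ≈ x
  enum-index x = proj₂ (enum-surjective x)

  _≟_ : ∀ x y → Dec (x ≈ y)
  x ≟ y with index x Fin.≟ index y
  ... | yes i≡j = yes (trans (sym (enum-index x)) (trans (reflexive (≡.cong enum i≡j)) (enum-index y)))
  ... | no  i≢j = no λ x≈y → i≢j (enum-injective _ _ (trans (enum-index x) (trans x≈y (sym (enum-index y)))))

  *-cancelˡ-≈ : ∀ {x y z} → ¬ (x ≈ 0#) → x * y ≈ x * z → y ≈ z
  *-cancelˡ-≈ {x} {y} {z} x≉0 xy≈xz with inverse x x≉0
  ... | w , xw≈1 = begin
    y             ≈⟨ expand y ⟩
    w * (x * y)   ≈⟨ *-congˡ xy≈xz ⟩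
    w * (x * z)   ≈⟨ expand z ⟨
    z             ∎
    where
    expand : ∀ u → u ≈ w * (x * u)
    expand u = begin
      u             ≈⟨ *-identityˡ u ⟨
      1# * u        ≈⟨ *-congʳ (trans (*-comm w x) xw≈1) ⟨
      w * x * u     ≈⟨ *-assoc w x u ⟩
      w * (x * u)   ∎

  integral : ∀ {x y} → ¬ (x ≈ 0#) → x * y ≈ 0# → y ≈ 0#
  integral x≉0 xy≈0 = *-cancelˡ-≈ x≉0 (trans xy≈0 (sym (zeroʳ _)))

  -- With 0 turned into the neutral factor 1, the product of the units becomes a product over the
  -- whole enumeration, and the units need no enumeration of their own.
  nonzeroPart : Carrier → Carrier
  nonzeroPart x with x ≟ 0#
  ... | yes _ = 1#
  ... | no  _ = x

  nonzeroPart-0 : ∀ {x} → x ≈ 0# → nonzeroPart x ≈ 1#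
  nonzeroPart-0 {x} x≈0 with x ≟ 0#
  ... | yes _   = refl
  ... | no  x≉0 = ⊥-elim (x≉0 x≈0)

  nonzeroPart-≉0 : ∀ {x} → ¬ (x ≈ 0#) → nonzeroPart x ≈ x
  nonzeroPart-≉0 {x} x≉0 with x ≟ 0#
  ... | yes x≈0 = ⊥-elim (x≉0 x≈0)
  ... | no  _   = refl

  nonzeroPart-cong : ∀ {x y} → x ≈ y → nonzeroPart x ≈ nonzeroPart y
  nonzeroPart-cong {x} {y} x≈y with x ≟ 0#
  ... | yes x≈0 = sym (nonzeroPart-0 (trans (sym x≈y) x≈0))
  ... | no  x≉0 = trans x≈y (sym (nonzeroPart-≉0 λ y≈0 → x≉0 (trans x≈y y≈0)))

  nonzeroPart-nonzero : ∀ x → ¬ (nonzeroPart x ≈ 0#)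
  nonzeroPart-nonzero x with x ≟ 0#
  ... | yes _   = 1≉0
  ... | no  x≉0 = x≉0

  prod-nonzero : ∀ {n} (f : Fin n → Carrier) → (∀ i → ¬ (f i ≈ 0#)) → ¬ (prod f ≈ 0#)
  prod-nonzero {zero}  f f≉0 = 1≉0
  prod-nonzero {suc n} f f≉0 = λ p → prod-nonzero (f ∘ suc) (f≉0 ∘ suc) (integral (f≉0 zero) p)

  -- Meant for the index of 0: there `a * nonzeroPart 0` exceeds `nonzeroPart (a * 0)` by one factor
  -- `a`, while all other factors agree.
  prod-differ-at : ∀ {n} (f g : Fin n → Carrier) i {x} → f i ≈ x * g i →
                   (∀ j → ¬ (j ≡ i) → f j ≈ g j) → prod f ≈ x * prod g
  prod-differ-at f g zero    fi rest =
    trans (*-cong fi (prod-cong λ j → rest (suc j) λ ())) (*-assoc _ _ _)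
  prod-differ-at f g (suc i) fi rest = trans
    (*-cong (rest zero λ ())
      (prod-differ-at (f ∘ suc) (g ∘ suc) i fi λ j j≢i → rest (suc j) (j≢i ∘ Fin.suc-injective)))
    (x∙yz≈y∙xz _ _ _)

  -- Multiplication by a permutes the field; comparing the products of the nonzero
  -- elements (0 being replaced by 1) gives a ^ q * P ≈ a * P.
  x^q≈x-nonzero : ∀ a → ¬ (a ≈ 0#) → a ^ q ≈ a
  x^q≈x-nonzero a a≉0 with inverse a a≉0
  ... | b , ab≈1 = *-cancelˡ-≈ (prod-nonzero _ λ i → nonzeroPart-nonzero (enum i)) (begin
    P * a ^ q                               ≈⟨ *-comm _ _ ⟩
    a ^ q * P                               ≈⟨ *-congʳ (prod-replicate q) ⟨
    prod {q} (λ _ → a) * P                  ≈⟨ prod-distrib-* {q} (λ _ → a) (nonzeroPart ∘ enum) ⟨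
    prod (λ i → a * nonzeroPart (enum i))   ≈⟨ prod-differ-at _ _ (index 0#) at-zero elsewhere ⟩
    a * prod (λ i → nonzeroPart (a * enum i))
      ≈⟨ *-congˡ (prod-cong λ i → nonzeroPart-cong (enum-index (a * enum i))) ⟨
    a * prod (λ i → nonzeroPart (enum (index (a * enum i))))
      ≈⟨ *-congˡ (prod-permute (nonzeroPart ∘ enum) π) ⟨
    a * P                                   ≈⟨ *-comm a P ⟩
    P * a                                   ∎)
    where
    P : Carrier
    P = prod (nonzeroPart ∘ enum)

    undo : ∀ u v → u * v ≈ 1# → ∀ i → index (u * enum (index (v * enum i))) ≡ i
    undo u v uv≈1 i = enum-injective _ _ (begin
      enum (index (u * enum (index (v * enum i))))   ≈⟨ enum-index _ ⟩
      u * enum (index (v * enum i))                  ≈⟨ *-congˡ (enum-index _) ⟩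
      u * (v * enum i)                               ≈⟨ *-assoc u v _ ⟨
      u * v * enum i                                 ≈⟨ *-congʳ uv≈1 ⟩
      1# * enum i                                    ≈⟨ *-identityˡ _ ⟩
      enum i                                         ∎)

    π = permutation (λ i → index (a * enum i)) (λ i → index (b * enum i))
          (undo a b ab≈1) (undo b a (trans (*-comm b a) ab≈1))

    at-zero : a * nonzeroPart (enum (index 0#)) ≈ a * nonzeroPart (a * enum (index 0#))
    at-zero = *-congˡ (trans (nonzeroPart-0 (enum-index 0#))
      (sym (nonzeroPart-0 (trans (*-congˡ (enum-index 0#)) (zeroʳ a)))))

    elsewhere : ∀ j → ¬ (j ≡ index 0#) → a * nonzeroPart (enum j) ≈ nonzeroPart (a * enum j)
    elsewhere j j≢ = trans (*-congˡ (nonzeroPart-≉0 enum≉0))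
      (sym (nonzeroPart-≉0 λ p → enum≉0 (integral a≉0 p)))
      where
      enum≉0 : ¬ (enum j ≈ 0#)
      enum≉0 p = j≢ (enum-injective _ _ (trans p (sym (enum-index 0#))))

  x^q≈x : ∀ x → x ^ q ≈ x
  x^q≈x x with x ≟ 0#
  ... | no  x≉0 = x^q≈x-nonzero x x≉0
  ... | yes x≈0 = trans (^-congˡ q x≈0) (trans (0^ (index 0#)) (sym x≈0))
    where
    0^ : ∀ {n} → Fin n → 0# ^ n ≈ 0#
    0^ {suc n} _ = zeroˡ _

  eval : ∀ {n} → Vec Carrier n → Carrier → Carrier
  eval []      x = 0#
  eval (a ∷ p) x = a + x * eval p x

  -- Synthetic division by `x - r`, constant term first: the coefficients of the quotient are the
  -- values at `r` of the successive tails of the polynomial.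
  quotient : ∀ {n} → Vec Carrier (suc n) → Carrier → Vec Carrier n
  quotient (_ ∷ [])        r = []
  quotient (_ ∷ p@(_ ∷ _)) r = eval p r ∷ quotient p r

  -- p(x) − p(r) = (x − r) · quotient(x), with no subtraction.
  quotient-spec : ∀ {n} (p : Vec Carrier (suc n)) r x →
    eval p x + r * eval (quotient p r) x ≈ eval p r + x * eval (quotient p r) x
  quotient-spec (a ∷ []) r x =
    solve 3 (λ a r x → (a :+ x :* con 0) :+ r :* con 0 := (a :+ r :* con 0) :+ x :* con 0) refl a r x
  quotient-spec (a ∷ p@(_ ∷ _)) r x = begin
    a + x * X + r * (E + x * Q)      ≈⟨ solve 6 (λ a x X r E Q → a :+ x :* X :+ r :* (E :+ x :* Q)
                                         := a :+ r :* E :+ x :* (X :+ r :* Q)) refl a x X r E Q ⟩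
    a + r * E + x * (X + r * Q)      ≈⟨ +-congˡ (*-congˡ (quotient-spec p r x)) ⟩
    a + r * E + x * (E + x * Q)      ∎
    where
    X = eval p x
    E = eval p r
    Q = eval (quotient p r) x

  -- The head of the quotient is the value of the tail at `r`. Its vanishing forces `a` to be 0 and
  -- is also the root hypothesis for the tail.
  quotient-zeros : ∀ {n} (p : Vec Carrier (suc n)) r →
    eval p r ≈ 0# → All (_≈ 0#) (quotient p r) → All (_≈ 0#) p
  quotient-zeros (a ∷ []) r p≈0 [] =
    trans (solve 2 (λ a r → a := a :+ r :* con 0) refl a r) p≈0 ∷ []
  quotient-zeros (a ∷ p@(_ ∷ _)) r p≈0 (e ∷ es) = head ∷ quotient-zeros p r e es
    where
    head : a ≈ 0#
    head = begin
      a                   ≈⟨ solve 2 (λ a r → a := a :+ r :* con 0) refl a r ⟩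
      a + r * 0#          ≈⟨ +-congˡ (*-congˡ e) ⟨
      a + r * eval p r    ≈⟨ p≈0 ⟩
      0#                  ∎

  -- After division by `x - r zero` the other points, being distinct from `r zero`, are roots of a
  -- quotient with one coefficient fewer.
  too-many-roots : ∀ {n} (p : Vec Carrier n) (r : Fin n → Carrier) →
    (∀ i j → r i ≈ r j → i ≡ j) → (∀ i → eval p (r i) ≈ 0#) → All (_≈ 0#) p
  too-many-roots {zero}  []        r r-inj root = []
  too-many-roots {suc n} p r r-inj root =
    quotient-zeros p (r zero) (root zero)
      (too-many-roots (quotient p (r zero)) (r ∘ suc)
        (λ i j eq → Fin.suc-injective (r-inj _ _ eq)) quotient-root)
    where
    quotient-root : ∀ i → eval (quotient p (r zero)) (r (suc i)) ≈ 0#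
    quotient-root i = integral x-a≉0 (begin
      (x - a) * Q       ≈⟨ distribʳ Q x (- a) ⟩
      x * Q + - a * Q   ≈⟨ +-congˡ (-‿distribˡ-* a Q) ⟨
      x * Q - a * Q     ≈⟨ x≈y⇒x∙y⁻¹≈ε xQ≈aQ ⟩
      0#                ∎)
      where
      a = r zero
      x = r (suc i)
      Q = eval (quotient p a) x

      x-a≉0 : ¬ (x - a ≈ 0#)
      x-a≉0 eq with () ← r-inj _ _ (x∙y⁻¹≈ε⇒x≈y x a eq)

      xQ≈aQ : x * Q ≈ a * Q
      xQ≈aQ = begin
        x * Q              ≈⟨ +-identityˡ _ ⟨
        0# + x * Q         ≈⟨ +-congʳ (root zero) ⟨
        eval p a + x * Q   ≈⟨ quotient-spec p a x ⟨
        eval p x + a * Q   ≈⟨ +-congʳ (root (suc i)) ⟩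
        0# + a * Q         ≈⟨ +-identityˡ _ ⟩
        a * Q              ∎

  eval-tabulate : ∀ n (f : Fin n → Carrier) x → eval (tabulate f) x ≈ sum (λ i → f i * x ^ toℕ i)
  eval-tabulate zero    f x = refl
  eval-tabulate (suc n) f x = +-cong (sym (*-identityʳ _)) (trans
    (*-congˡ (eval-tabulate n (f ∘ suc) x))
    (trans (*-distribˡ-sum x (λ i → f (suc i) * x ^ toℕ i)) (sum-cong-≋ λ i → x∙yz≈y∙xz x (f (suc i)) _)))

  -- (x + 1)^q − x^q − 1 has degree less than q and vanishes on the whole field.
  binomial-vanishes : ∀ k → 0 < k → k < q → (q C k) × 1# ≈ 0#
  binomial-vanishes = go q enum enum-injective x^q≈x
    where
    -- Generalized from `q` to a variable `n`, so that the exponent can be matched as a successor.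
    go : ∀ n (e : Fin n → Carrier) → (∀ i j → e i ≈ e j → i ≡ j) → (∀ x → x ^ n ≈ x) →
         ∀ k → 0 < k → k < n → (n C k) × 1# ≈ 0#
    go (suc n) e e-inj fermat (suc k) _ (s≤s k<n) = trans
      (reflexive (≡.cong (λ j → (suc n C suc j) × 1#) (≡.sym (Fin.toℕ-fromℕ< k<n))))
      -- With constant term 0 and `f i` as the coefficient of `x^(i+1)`, the vector has exactly
      -- `suc n` entries, as many as there are roots.
      (coefficients (tail (too-many-roots (0# ∷ tabulate f) e e-inj (λ i → vanish (e i)))) (fromℕ< k<n))
      where
      f : Fin n → Carrier
      f i = (suc n C suc (toℕ i)) × 1#

      coefficients : All (_≈ 0#) (tabulate f) → ∀ i → f i ≈ 0#
      coefficients = tabulate⁻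

      tail : ∀ {m x} {v : Vec Carrier m} → All (_≈ 0#) (x ∷ v) → All (_≈ 0#) v
      tail (_ ∷ a) = a

      1^ : ∀ m → 1# ^ m ≈ 1#
      1^ zero    = refl
      1^ (suc m) = trans (*-identityˡ _) (1^ m)

      middle : ∀ x → Carrier
      middle x = sum {n} (λ i → (suc n C suc (toℕ i)) × (x ^ suc (toℕ i) * 1# ^ (n ∸ toℕ i)))

      -- The binomial expansion of `(x + 1)^q = x + 1`, from which the end terms `x^q = x` and 1 are
      -- cancelled.
      middle≈0 : ∀ x → middle x ≈ 0#
      middle≈0 x = ∙-cancelʳ x _ _ (∙-cancelˡ 1# _ _ (begin
        1# + (middle x + x)                        ≈⟨ +-cong (1^ (suc n)) (+-congˡ (fermat x)) ⟨
        1# ^ suc n + (middle x + x ^ suc n)        ≈⟨ BinomialSplit.binomial-split commRing n x 1# ⟨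
        (x + 1#) ^ suc n                           ≈⟨ fermat (x + 1#) ⟩
        x + 1#                                     ≈⟨ solve 1 (λ x → x :+ con 1 := con 1 :+ (con 0 :+ x)) refl x ⟩
        1# + (0# + x)                              ∎))

      vanish : ∀ x → eval (0# ∷ tabulate f) x ≈ 0#
      vanish x = begin
        0# + x * eval (tabulate f) x                   ≈⟨ +-identityˡ _ ⟩
        x * eval (tabulate f) x                        ≈⟨ *-congˡ (eval-tabulate n f x) ⟩
        x * sum (λ i → f i * x ^ toℕ i)                ≈⟨ *-distribˡ-sum x (λ i → f i * x ^ toℕ i) ⟩
        sum (λ i → x * (f i * x ^ toℕ i))              ≈⟨ sum-cong-≋ term ⟩
        middle x                                       ≈⟨ middle≈0 x ⟩
        0#                                             ∎
        where
        term : ∀ i → x * (f i * x ^ toℕ i) ≈ (suc n C suc (toℕ i)) × (x ^ suc (toℕ i) * 1# ^ (n ∸ toℕ i))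
        term i = begin
          x * (f i * x ^ toℕ i)                ≈⟨ x∙yz≈y∙xz _ _ _ ⟩
          f i * x ^ suc (toℕ i)                ≈⟨ ×-assoc-* (suc n C suc (toℕ i)) _ _ ⟩
          (suc n C suc (toℕ i)) × (1# * x ^ suc (toℕ i))
            ≈⟨ ×-congʳ (suc n C suc (toℕ i)) (trans (*-comm _ _) (*-congˡ (sym (1^ (n ∸ toℕ i))))) ⟩
          (suc n C suc (toℕ i)) × (x ^ suc (toℕ i) * 1# ^ (n ∸ toℕ i)) ∎

-- The Frobenius endomorphism

-- Takes the place of "`q` is a power of the characteristic". It yields additivity of `x ↦ x^q` and,
-- as it speaks only of multiples of 1, passes easily to power series and fractions.
BinomialsVanish : ∀ {c ℓ} → CommutativeRing c ℓ → ℕ → Set ℓ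
BinomialsVanish R q = ∀ k → 0 < k → k < q → (q C k) × 1# ≈ 0#
  where
  open CommutativeRing R
  open Mult semiring using (_×_)

series-binomialsVanish : ∀ {c ℓ} (R : CommutativeRing c ℓ) {q} →
  BinomialsVanish R q → BinomialsVanish (PowerSeries.seriesRing R) q
series-binomialsVanish R {q} vanish k 0<k k<q j = trans (reflexive (×-coefficient (q C k) j)) (at j)
  where
  open CommutativeRing R hiding (zero)
  open PowerSeries R using (𝟙; seriesRing)
  open Mult semiring using (_×_; ×-congʳ; ×-comm-*)
  open Mult (CommutativeRing.semiring seriesRing) using () renaming (_×_ to _×ₛ_)

  ×-coefficient : ∀ m j → (m ×ₛ 𝟙) j ≡ m × 𝟙 j
  ×-coefficient zero    j = ≡.refl
  ×-coefficient (suc m) j = ≡.cong (𝟙 j +_) (×-coefficient m j)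

  at : ∀ j → (q C k) × 𝟙 j ≈ 0#
  at zero    = vanish k 0<k k<q
  at (suc _) = trans (×-congʳ (q C k) (sym (zeroˡ 0#)))
                 (trans (sym (×-comm-* (q C k) 0# 0#)) (zeroˡ _))

fraction-binomialsVanish : ∀ {c ℓ} (R : CommutativeRing c ℓ) {q} →
  BinomialsVanish R q → BinomialsVanish (Fractions.fractionRing R) q
fraction-binomialsVanish R {q} vanish k 0<k k<q =
  K.trans (embed-× (q C k)) (embed-cong (vanish k 0<k k<q))
  where
  open CommutativeRing R hiding (zero)
  open Fractions R using (embed; fractionRing; _≃_; embed-+; embed-cong)
  module K = CommutativeRing fractionRing
  open Mult semiring using (_×_)
  open Mult K.semiring using () renaming (_×_ to _×ₖ_)

  embed-× : ∀ m → m ×ₖ embed 1# ≃ embed (m × 1#)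
  embed-× zero    = K.refl
  embed-× (suc m) = K.trans (K.+-congˡ (embed-× m)) (embed-+ 1# (m × 1#))

module RingFacts {c ℓ} (R : CommutativeRing c ℓ) where
  open CommutativeRing R hiding (zero)
  open Exp commutativeSemiring using (_^_; ^-homo-*; ^-distrib-*)
  open BigOperator +-commutativeMonoid using () renaming (fold to ∑)
  open BigOperator *-commutativeMonoid using () renaming (fold to ∏)
  open SetoidReasoning setoid

  *-distribˡ-∑ : ∀ n x f → x * ∑ n f ≈ ∑ n (λ i → x * f i)
  *-distribˡ-∑ zero    x f = zeroʳ x
  *-distribˡ-∑ (suc n) x f = trans (distribˡ _ _ _) (+-congʳ (*-distribˡ-∑ n x f))

  *-distribʳ-∑ : ∀ n x f → ∑ n f * x ≈ ∑ n (λ i → f i * x)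
  *-distribʳ-∑ zero    x f = zeroˡ x
  *-distribʳ-∑ (suc n) x f = trans (distribʳ _ _ _) (+-congʳ (*-distribʳ-∑ n x f))

  1^n≈1 : ∀ n → 1# ^ n ≈ 1#
  1^n≈1 zero    = refl
  1^n≈1 (suc n) = trans (*-identityˡ _) (1^n≈1 n)

  ^-sumℕ : ∀ x n f → x ^ sumℕ n f ≈ ∏ n (λ i → x ^ f i)
  ^-sumℕ x zero    f = refl
  ^-sumℕ x (suc n) f = trans (^-homo-* x (sumℕ n f) (f n)) (*-congʳ (^-sumℕ x n f))

  ∏-^ : ∀ n f k → ∏ n f ^ k ≈ ∏ n (λ i → f i ^ k)
  ∏-^ zero    f k = 1^n≈1 k
  ∏-^ (suc n) f k = trans (^-distrib-* _ _ k) (*-congʳ (∏-^ n f k))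

  x-z≈[x-y]+[y-z] : ∀ x y z → x - z ≈ (x - y) + (y - z)
  x-z≈[x-y]+[y-z] x y z = sym (begin
    (x - y) + (y - z)     ≈⟨ +-assoc x (- y) (y - z) ⟩
    x + (- y + (y - z))   ≈⟨ +-congˡ (+-assoc (- y) y (- z)) ⟨
    x + (- y + y - z)     ≈⟨ +-congˡ (+-congʳ (-‿inverseˡ y)) ⟩
    x + (0# - z)          ≈⟨ +-congˡ (+-identityˡ (- z)) ⟩
    x - z                 ∎)

module Frobenius {c ℓ} (R : CommutativeRing c ℓ) (q : ℕ) (1<q : 1 < q)
                 (vanish : BinomialsVanish R q) where
  open CommutativeRing R hiding (zero)
  open Exp commutativeSemiring using (_^_; ^-congˡ; ^-congʳ; ^-assocʳ)
  open Mult semiring using (_×_; ×-congʳ; ×-assoc-*)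
  open CommutativeMonoidSum +-commutativeMonoid using (sum; sum-cong-≋; sum-replicate-zero)
  open BigOperator +-commutativeMonoid using () renaming (fold to ∑)
  open GroupProperties +-group using (inverseˡ-unique; ∙-cancelˡ)
  open SetoidReasoning setoid

  ^q-+ : ∀ x y → (x + y) ^ q ≈ x ^ q + y ^ q
  ^q-+ x y = go q 1<q vanish
    where
    go : ∀ m → 1 < m → BinomialsVanish R m → (x + y) ^ m ≈ x ^ m + y ^ m
    go (suc m) _ vanish = begin
      (x + y) ^ suc m                      ≈⟨ BinomialSplit.binomial-split R m x y ⟩
      y ^ suc m + (sum {m} _ + x ^ suc m)      ≈⟨ +-congˡ (+-congʳ (trans (sum-cong-≋ {m} term) (sum-replicate-zero m))) ⟩
      y ^ suc m + (0# + x ^ suc m)         ≈⟨ +-congˡ (+-identityˡ _) ⟩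
      y ^ suc m + x ^ suc m                ≈⟨ +-comm _ _ ⟩
      x ^ suc m + y ^ suc m                ∎
      where
      term : ∀ (i : Fin m) → (suc m C suc (toℕ i)) × (x ^ suc (toℕ i) * y ^ (m ∸ toℕ i)) ≈ 0#
      term i = begin
        (suc m C suc (toℕ i)) × z            ≈⟨ ×-congʳ (suc m C suc (toℕ i)) (*-identityˡ z) ⟨
        (suc m C suc (toℕ i)) × (1# * z)     ≈⟨ ×-assoc-* (suc m C suc (toℕ i)) 1# z ⟨
        ((suc m C suc (toℕ i)) × 1#) * z     ≈⟨ *-congʳ (vanish (suc (toℕ i)) (s≤s z≤n) (s≤s (Fin.toℕ<n i))) ⟩
        0# * z                               ≈⟨ zeroˡ z ⟩
        0#                                   ∎
        where z = x ^ suc (toℕ i) * y ^ (m ∸ toℕ i)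

  φ : ℕ → Carrier → Carrier
  φ i x = x ^ (q ℕ.^ i)

  φ-cong : ∀ i {x y} → x ≈ y → φ i x ≈ φ i y
  φ-cong i = ^-congˡ (q ℕ.^ i)

  φ-0th : ∀ x → φ 0 x ≈ x
  φ-0th x = *-identityʳ x

  φ-φ : ∀ i j x → φ j (φ i x) ≈ φ (i ℕ.+ j) x
  φ-φ i j x = trans (^-assocʳ x (q ℕ.^ i) (q ℕ.^ j))
    (^-congʳ x (≡.sym (ℕ.^-distribˡ-+-* q i j)))

  φ-+ : ∀ i x y → φ i (x + y) ≈ φ i x + φ i y
  φ-+ zero    x y = trans (φ-0th _) (+-cong (sym (φ-0th x)) (sym (φ-0th y)))
  φ-+ (suc i) x y = begin
    φ (suc i) (x + y)              ≈⟨ ^-assocʳ (x + y) q _ ⟨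
    φ i ((x + y) ^ q)              ≈⟨ φ-cong i (^q-+ x y) ⟩
    φ i (x ^ q + y ^ q)            ≈⟨ φ-+ i (x ^ q) (y ^ q) ⟩
    φ i (x ^ q) + φ i (y ^ q)      ≈⟨ +-cong (^-assocʳ x q _) (^-assocʳ y q _) ⟩
    φ (suc i) x + φ (suc i) y      ∎

  φ-0 : ∀ i → φ i 0# ≈ 0#
  φ-0 i = ∙-cancelˡ (φ i 0#) _ _ (begin
    φ i 0# + φ i 0#   ≈⟨ φ-+ i 0# 0# ⟨
    φ i (0# + 0#)     ≈⟨ φ-cong i (+-identityʳ 0#) ⟩
    φ i 0#            ≈⟨ +-identityʳ _ ⟨
    φ i 0# + 0#       ∎)

  φ-neg : ∀ i x → φ i (- x) ≈ - φ i x
  φ-neg i x = inverseˡ-unique _ _ (begin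
    φ i (- x) + φ i x   ≈⟨ φ-+ i (- x) x ⟨
    φ i (- x + x)       ≈⟨ φ-cong i (-‿inverseˡ x) ⟩
    φ i 0#              ≈⟨ φ-0 i ⟩
    0#                  ∎)

  φ-sub : ∀ i x y → φ i (x - y) ≈ φ i x - φ i y
  φ-sub i x y = trans (φ-+ i x (- y)) (+-congˡ (φ-neg i y))

  φ-∑ : ∀ i n f → φ i (∑ n f) ≈ ∑ n (λ j → φ i (f j))
  φ-∑ i zero    f = φ-0 i
  φ-∑ i (suc n) f = trans (φ-+ i _ _) (+-congʳ (φ-∑ i n f))

-- Sums of powers of q and sparse series

open import Data.Product.Base using (_×_)

-- Since `nil` is available for every `w`, the weight only bounds the number of summands from above.
data PowersSum (q : ℕ) : ℕ → ℕ → Set where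
  nil  : ∀ {w} → PowersSum q w 0
  cons : ∀ {w N} i → PowersSum q w N → PowersSum q (suc w) (q ℕ.^ i ℕ.+ N)

module PowersSumProperties (q : ℕ) where

  weaken : ∀ {w w′ N} → w ≤ w′ → PowersSum q w N → PowersSum q w′ N
  weaken w≤w′       nil        = nil
  weaken (s≤s w≤w′) (cons i p) = cons i (weaken w≤w′ p)

  append : ∀ {w w′ N N′} → PowersSum q w N → PowersSum q w′ N′ → PowersSum q (w ℕ.+ w′) (N ℕ.+ N′)
  append {w} {w′} nil r = weaken (ℕ.m≤n+m w′ w) r
  append {N′ = N′} (cons {N = N} i p) r =
    ≡.subst (PowersSum q _) (≡.sym (ℕ.+-assoc (q ℕ.^ i) N N′)) (cons i (append p r))

  ones : ∀ k → PowersSum q k k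
  ones zero    = nil
  ones (suc k) = cons 0 (ones k)

  -- Removes the lowest digit: `u` counts the summands equal to 1, and `M` collects the remaining
  -- ones divided by `q`, each still a power of `q`.
  split-units : ∀ {w N} → PowersSum q w N →
    ∃ λ u → ∃₂ λ v M → N ≡ u ℕ.+ q ℕ.* M × PowersSum q v M × u ℕ.+ v ≤ w
  split-units nil = 0 , 0 , 0 , ≡.sym (ℕ.*-zeroʳ q) , nil , z≤n
  split-units (cons {w} {N} zero p) with split-units p
  ... | u , v , M , eq , r , le = suc u , v , M , ≡.cong suc eq , r , s≤s le
  split-units (cons {w} {N} (suc i) p) with split-units p
  ... | u , v , M , eq , r , le =
    u , suc v , q ℕ.^ i ℕ.+ M , ≡.trans (≡.cong (q ℕ.* q ℕ.^ i ℕ.+_) eq) (rearrange u M) , cons i r ,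
    ≡.subst (_≤ suc w) (≡.sym (ℕ.+-suc u v)) (s≤s le)
    where
    rearrange : ∀ u M → q ℕ.* q ℕ.^ i ℕ.+ (u ℕ.+ q ℕ.* M) ≡ u ℕ.+ q ℕ.* (q ℕ.^ i ℕ.+ M)
    rearrange u M = solve 4 (λ q p u M → q :* p :+ (u :+ q :* M) := u :+ q :* (p :+ M)) ≡.refl q (q ℕ.^ i) u M
      where open +-*-Solver

open PowersSumProperties

-- The base-q digits of q ^ n - 1 are all q - 1, so it needs n (q - 1) powers of q.
powersSum-bound : ∀ p n {w N} → suc N ≡ suc p ℕ.^ n → PowersSum (suc p) w N → n ℕ.* p ≤ w
powersSum-bound p zero    eq s = z≤n
powersSum-bound p (suc n) {w} {N} eq s with split-units (suc p) s
... | u , v , M , N≡ , r , u+v≤w = conclude (ℕ.≤-total (suc p ℕ.^ n) M)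
  where
  q = suc p
  open ℕ.≤-Reasoning

  N+1≡ : suc u ℕ.+ q ℕ.* M ≡ q ℕ.* q ℕ.^ n
  N+1≡ = ≡.trans (≡.cong suc (≡.sym N≡)) eq

  absurd : q ℕ.^ n ≤ M → n ℕ.* p ℕ.+ p ≤ w
  absurd le = ⊥-elim (ℕ.<-irrefl ≡.refl (begin-strict
    q ℕ.* q ℕ.^ n           ≤⟨ ℕ.*-monoʳ-≤ q le ⟩
    q ℕ.* M                 <⟨ s≤s (ℕ.m≤n+m (q ℕ.* M) u) ⟩
    suc u ℕ.+ q ℕ.* M       ≡⟨ N+1≡ ⟩
    q ℕ.* q ℕ.^ n           ∎))

  -- With q ^ n = M + 1 + k, the number u of units is p + q k; trade the q k extra ones for k.
  main : ∀ k → q ℕ.^ n ≡ suc (k ℕ.+ M) → n ℕ.* p ℕ.+ p ≤ w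
  main k eq′ = begin
    n ℕ.* p ℕ.+ p        ≤⟨ ℕ.+-monoˡ-≤ p (powersSum-bound p n (≡.sym eq′) (append q (ones q k) r)) ⟩
    k ℕ.+ v ℕ.+ p        ≤⟨ ℕ.m≤m+n (k ℕ.+ v ℕ.+ p) (p ℕ.* k) ⟩
    k ℕ.+ v ℕ.+ p ℕ.+ p ℕ.* k   ≡⟨ solve 3 (λ k v p → k :+ v :+ p :+ p :* k := p :+ (con 1 :+ p) :* k :+ v) ≡.refl k v p ⟩
    p ℕ.+ q ℕ.* k ℕ.+ v  ≡⟨ ≡.cong (ℕ._+ v) u≡ ⟨
    u ℕ.+ v              ≤⟨ u+v≤w ⟩
    w                    ∎
    where
    open +-*-Solver
    u≡ : u ≡ p ℕ.+ q ℕ.* k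
    u≡ = ℕ.suc-injective (ℕ.+-cancelʳ-≡ (q ℕ.* M) (suc u) (suc (p ℕ.+ q ℕ.* k)) (≡.trans N+1≡
      (≡.trans (≡.cong (q ℕ.*_) eq′)
        (solve 3 (λ p k M → (con 1 :+ p) :* (con 1 :+ (k :+ M))
                   := con 1 :+ (p :+ (con 1 :+ p) :* k) :+ (con 1 :+ p) :* M) ≡.refl p k M))))

  conclude : q ℕ.^ n ≤ M ⊎ M ≤ q ℕ.^ n → p ℕ.+ n ℕ.* p ≤ w
  conclude (inj₁ le) = ≡.subst (_≤ w) (ℕ.+-comm (n ℕ.* p) p) (absurd le)
  conclude (inj₂ le) with ℕ.m≤n⇒m<n∨m≡n le
  ... | inj₂ M≡ = conclude (inj₁ (ℕ.≤-reflexive (≡.sym M≡)))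
  ... | inj₁ lt = ≡.subst (_≤ w) (ℕ.+-comm (n ℕ.* p) p) (main (q ℕ.^ n ∸ suc M)
    (≡.trans (≡.sym (ℕ.m∸n+n≡m lt)) (ℕ.+-suc (q ℕ.^ n ∸ suc M) M)))

-- Orders of vanishing and supports of power series

module SeriesFacts {c ℓ} (K : CommutativeRing c ℓ) where
  open CommutativeRing K hiding (zero)
  open PowerSeries K public
  module S = CommutativeRing seriesRing
  open Exp S.commutativeSemiring public using () renaming (_^_ to _^ₛ_)
  open Exp commutativeSemiring using (_^_)
  open BigOperator +-commutativeMonoid using () renaming (fold to ∑)
  open BigOperator S.+-commutativeMonoid public using () renaming (fold to ∑ₛ)
  open SetoidReasoning setoid

  X : Series
  X zero    = 0#
  X (suc n) = 𝟙 n

  κ : Carrier → Series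
  κ x zero    = x
  κ x (suc _) = 0#

  κ-⊛ : ∀ x f n → (κ x ⊛ f) n ≈ x * f n
  κ-⊛ x f zero    = refl
  κ-⊛ x f (suc n) = trans (+-congˡ (⊛-zeroˡ f n)) (+-identityʳ _)

  κ-^ : ∀ x m → κ x ^ₛ m ≋ κ (x ^ m)
  κ-^ x zero    zero    = refl
  κ-^ x zero    (suc n) = refl
  κ-^ x (suc m) n = trans (κ-⊛ x (κ x ^ₛ m) n) (trans (*-congˡ (κ-^ x m n)) (κ-scale n))
    where
    κ-scale : ∀ n → x * κ (x ^ m) n ≈ κ (x * x ^ m) n
    κ-scale zero    = refl
    κ-scale (suc n) = zeroʳ x

  ∑ₛ-coefficient : ∀ m f n → ∑ₛ m f n ≡ ∑ m (λ i → f i n)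
  ∑ₛ-coefficient zero    f n = ≡.refl
  ∑ₛ-coefficient (suc m) f n = ≡.cong (_+ f m n) (∑ₛ-coefficient m f n)

  X^-shift : ∀ k f n → (X ^ₛ k ⊛ f) (k ℕ.+ n) ≈ f n
  X^-shift zero    f n = ⊛-identityˡ f n
  X^-shift (suc k) f n = begin
    ((X ⊛ X ^ₛ k) ⊛ f) (suc (k ℕ.+ n))                  ≈⟨ ⊛-assoc X (X ^ₛ k) f (suc (k ℕ.+ n)) ⟩
    0# * (X ^ₛ k ⊛ f) (suc (k ℕ.+ n)) + (𝟙 ⊛ (X ^ₛ k ⊛ f)) (k ℕ.+ n)
      ≈⟨ +-cong (zeroˡ _) (⊛-identityˡ (X ^ₛ k ⊛ f) (k ℕ.+ n)) ⟩
    0# + (X ^ₛ k ⊛ f) (k ℕ.+ n)                         ≈⟨ +-identityˡ _ ⟩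
    (X ^ₛ k ⊛ f) (k ℕ.+ n)                              ≈⟨ X^-shift k f n ⟩
    f n                                                 ∎

  -- Divisibility by `X^p`.
  Vanish : ℕ → Series → Set ℓ
  Vanish p f = ∀ j → j < p → f j ≈ 0#

  vanish-⊛ : ∀ p s {f g} → Vanish p f → Vanish s g → Vanish (p ℕ.+ s) (f ⊛ g)
  vanish-⊛ zero    s vf vg zero    j<s = trans (*-congˡ (vg 0 j<s)) (zeroʳ _)
  vanish-⊛ zero    s {f} vf vg (suc j) j<s = trans
    (+-cong (trans (*-congˡ (vg (suc j) j<s)) (zeroʳ _))
            (vanish-⊛ zero s {f ∘ suc} (λ _ ()) vg j (ℕ.<-trans (ℕ.n<1+n j) j<s)))
    (+-identityʳ 0#)
  vanish-⊛ (suc p) s vf vg zero    j<s = trans (*-congʳ (vf 0 (s≤s z≤n))) (zeroˡ _)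
  vanish-⊛ (suc p) s {f} vf vg (suc j) (s≤s j<s) = trans
    (+-cong (trans (*-congʳ (vf 0 (s≤s z≤n))) (zeroˡ _))
            (vanish-⊛ p s {f ∘ suc} (λ i i<p → vf (suc i) (s≤s i<p)) vg j j<s))
    (+-identityʳ 0#)

  leading-⊛ : ∀ p s {f g} → Vanish p f → Vanish s g → (f ⊛ g) (p ℕ.+ s) ≈ f p * g s
  leading-⊛ zero    zero    vf vg = refl
  leading-⊛ zero    (suc s) {f} {g} vf vg = trans
    (+-congˡ (vanish-⊛ zero (suc s) {f ∘ suc} (λ _ ()) vg s (ℕ.n<1+n s))) (+-identityʳ _)
  leading-⊛ (suc p) s {f} vf vg = trans
    (+-cong (trans (*-congʳ (vf 0 (s≤s z≤n))) (zeroˡ _))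
            (leading-⊛ p s {f ∘ suc} (λ i i<p → vf (suc i) (s≤s i<p)) vg))
    (+-identityˡ _)

  vanish-^ : ∀ p m {f} → Vanish p f → Vanish (m ℕ.* p) (f ^ₛ m)
  vanish-^ p zero    vf _ ()
  vanish-^ p (suc m) vf = vanish-⊛ p (m ℕ.* p) vf (vanish-^ p m vf)

  leading-^ : ∀ p m {f} → Vanish p f → (f ^ₛ m) (m ℕ.* p) ≈ f p ^ m
  leading-^ p zero    vf = refl
  leading-^ p (suc m) vf = trans (leading-⊛ p (m ℕ.* p) vf (vanish-^ p m vf)) (*-congˡ (leading-^ p m vf))

  X-vanish : Vanish 1 X
  X-vanish zero    _        = refl
  X-vanish (suc _) (s≤s ())

  X^-vanish : ∀ k → Vanish k (X ^ₛ k)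
  X^-vanish k j j<k = vanish-^ 1 k X-vanish j (≡.subst (j <_) (≡.sym (ℕ.*-identityʳ k)) j<k)

  X^-⊛-vanish : ∀ k f → Vanish k (X ^ₛ k ⊛ f)
  X^-⊛-vanish k f j j<k = vanish-⊛ k 0 {g = f} (X^-vanish k) (λ _ ()) j
    (≡.subst (j <_) (≡.sym (ℕ.+-identityʳ k)) j<k)

  ⊛-cong-≤ : ∀ n {f f′ g g′} → (∀ j → j ≤ n → f j ≈ f′ j) → (∀ j → j ≤ n → g j ≈ g′ j) →
             ∀ j → j ≤ n → (f ⊛ g) j ≈ (f′ ⊛ g′) j
  ⊛-cong-≤ n p r zero    j≤n = *-cong (p 0 z≤n) (r 0 z≤n)
  ⊛-cong-≤ (suc n) p r (suc j) (s≤s j≤n) = +-cong (*-cong (p 0 z≤n) (r (suc j) (s≤s j≤n)))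
    (⊛-cong-≤ n (λ i i≤n → p (suc i) (s≤s i≤n)) (λ i i≤n → r i (ℕ.m≤n⇒m≤1+n i≤n)) j j≤n)

  X^-beyond : ∀ k j → k < j → (X ^ₛ k) j ≈ 0#
  X^-beyond k j k<j with j ∸ k | ℕ.m+[n∸m]≡n (ℕ.<⇒≤ k<j) | ℕ.m<n⇒0<n∸m k<j
  ... | suc d | ≡.refl | _ = begin
    (X ^ₛ k) (k ℕ.+ suc d)          ≈⟨ S.*-identityʳ (X ^ₛ k) (k ℕ.+ suc d) ⟨
    (X ^ₛ k ⊛ 𝟙) (k ℕ.+ suc d)      ≈⟨ X^-shift k 𝟙 (suc d) ⟩
    0#                              ∎

  -- A disjunction for each exponent, because the ring comes with no decision whether a coefficient
  -- is zero. In sums and products a `PowersSum` witness depends on the exponent alone.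
  Sparse : ℕ → ℕ → Series → Set ℓ
  Sparse q w f = ∀ j → f j ≈ 0# ⊎ PowersSum q w j

  sparse-+ : ∀ {q w} {j} {x y} → x ≈ 0# ⊎ PowersSum q w j → y ≈ 0# ⊎ PowersSum q w j →
             x + y ≈ 0# ⊎ PowersSum q w j
  sparse-+ (inj₁ x≈0) (inj₁ y≈0) = inj₁ (trans (+-cong x≈0 y≈0) (+-identityʳ 0#))
  sparse-+ (inj₁ _)   (inj₂ p)   = inj₂ p
  sparse-+ (inj₂ p)   _          = inj₂ p

  sparse-∑ : ∀ {q w j} m {f} → (∀ i → i < m → f i ≈ 0# ⊎ PowersSum q w j) → ∑ m f ≈ 0# ⊎ PowersSum q w j
  sparse-∑ zero    p = inj₁ refl
  sparse-∑ (suc m) p = sparse-+ (sparse-∑ m λ i i<m → p i (ℕ.m<n⇒m<1+n i<m)) (p m ℕ.≤-refl)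

  sparse-≈ : ∀ {q w j x y} → x ≈ y → y ≈ 0# ⊎ PowersSum q w j → x ≈ 0# ⊎ PowersSum q w j
  sparse-≈ x≈y (inj₁ y≈0) = inj₁ (trans x≈y y≈0)
  sparse-≈ x≈y (inj₂ p)   = inj₂ p

  sparse-⊛ : ∀ {q w w′ f g} → Sparse q w f → Sparse q w′ g → Sparse q (w ℕ.+ w′) (f ⊛ g)
  sparse-⊛ {q} {w} {w′} {f} {g} sf sg j =
    sparse-≈ (⊛-as-sum f g j) (sparse-∑ (suc j) λ i i≤j → term i (ℕ.s≤s⁻¹ i≤j))
    where
    term : ∀ i → i ≤ j → f i * g (j ∸ i) ≈ 0# ⊎ PowersSum q (w ℕ.+ w′) j
    term i i≤j with sf i | sg (j ∸ i)
    ... | inj₁ p | _      = inj₁ (trans (*-congʳ p) (zeroˡ _))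
    ... | inj₂ _ | inj₁ r = inj₁ (trans (*-congˡ r) (zeroʳ _))
    ... | inj₂ p | inj₂ r = inj₂ (≡.subst (PowersSum q _) (ℕ.m+[n∸m]≡n i≤j) (append q p r))

  sparse-1 : ∀ {q w} → Sparse q w 𝟙
  sparse-1 zero    = inj₂ nil
  sparse-1 (suc _) = inj₁ refl

  sparse-^ : ∀ {q f} m → Sparse q 1 f → Sparse q m (f ^ₛ m)
  sparse-^ zero    sf = sparse-1
  sparse-^ (suc m) sf = sparse-⊛ sf (sparse-^ m sf)

  sparse-X^ : ∀ {q} i → Sparse q 1 (X ^ₛ (q ℕ.^ i))
  sparse-X^ {q} i j with ℕ.<-cmp j (q ℕ.^ i)
  ... | tri< j<k _ _ = inj₁ (X^-vanish (q ℕ.^ i) j j<k)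
  ... | tri≈ _ ≡.refl _ = inj₂ (≡.subst (PowersSum q 1) (ℕ.+-identityʳ _) (cons i nil))
  ... | tri> _ _ k<j = inj₁ (X^-beyond (q ℕ.^ i) j k<j)

-- Inverting 1 - e

-- What the series argument uses about its coefficients: `τ` and `ϑ` stand for `t` and `θ`, `a` for
-- the coefficients of `e`, `S` for the partial sums of the logarithm coefficients. Both sequences
-- are given by recursions cleared of denominators, so `K` needs no division.
record ExpLog {c ℓ} (K : CommutativeRing c ℓ) (q : ℕ) : Set (c ⊔ ℓ) where
  open CommutativeRing K
  open Exp commutativeSemiring using (_^_)
  field
    1<q           : 1 < q
    vanish        : BinomialsVanish K q
    τ ϑ           : Carrier
    τ-regular     : ∀ n x → x * (τ ^ (q ℕ.^ suc n) - τ) ≈ 0# → x ≈ 0#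
    a S           : ℕ → Carrier
    a-zero        : a 0 ≈ 1#
    a-suc         : ∀ j → a (suc j) * (τ ^ (q ℕ.^ suc j) - τ)
                          ≈ a j ^ (q ℕ.^ 1) * (τ ^ (q ℕ.^ suc j) - ϑ ^ (q ℕ.^ 1))
    S-zero        : S 0 ≈ 1#
    S-suc         : ∀ d → S (suc d) * (τ - τ ^ (q ℕ.^ suc d)) ≈ S d * (τ - ϑ ^ (q ℕ.^ suc d))

-- The telescoping sum behind the logarithm

module LogExp {c ℓ} {K : CommutativeRing c ℓ} {q : ℕ} (E : ExpLog K q) where
  open CommutativeRing K hiding (zero)
  open ExpLog E
  open Exp commutativeSemiring using (_^_; ^-distrib-*)
  open BigOperator +-commutativeMonoid using () renaming (fold to ∑)
  open RingFacts K using (x-z≈[x-y]+[y-z])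
  open Frobenius K q 1<q vanish using (φ; φ-cong; φ-0th; φ-φ; φ-sub)
  open SetoidReasoning setoid
  private module Solver = SemiringSolver commutativeSemiring
  open Solver using (solve; _:*_; _:+_; _:=_; con)

  l : ℕ → Carrier
  l zero    = 1#
  l (suc d) = S (suc d) - S d

  restore : ∀ x y → (x - y) + y ≈ x
  restore x y = trans (+-assoc x (- y) y) (trans (+-congˡ (-‿inverseˡ y)) (+-identityʳ x))

  ∑l≈S : ∀ d → ∑ (suc d) l ≈ S d
  ∑l≈S zero    = trans (+-identityˡ 1#) (sym S-zero)
  ∑l≈S (suc d) = trans (+-congʳ (∑l≈S d)) (trans (+-comm _ _) (restore _ _))

  module _ (m : ℕ) where
    A : ℕ → Carrier
    A i = φ i (a (m ∸ i))

    -- This is `a-suc` at index `m - r - 1`, raised to the power `q^r`.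
    A-step : ∀ r → r < m → A r * (φ m τ - φ r τ) ≈ A (suc r) * (φ m τ - φ (suc r) ϑ)
    A-step r r<m = begin
      φ r (a (m ∸ r)) * (φ m τ - φ r τ)
        ≡⟨ ≡.cong₂ (λ u v → φ r (a u) * (φ v τ - φ r τ)) m∸r≡1+j (≡.sym 1+j+r≡m) ⟩
      φ r (a (suc j)) * (φ (suc j ℕ.+ r) τ - φ r τ)
        ≈⟨ *-congˡ (trans (φ-sub r _ _) (+-congʳ (φ-φ (suc j) r τ))) ⟨
      φ r (a (suc j)) * φ r (φ (suc j) τ - τ)
        ≈⟨ ^-distrib-* _ _ (q ℕ.^ r) ⟨
      φ r (a (suc j) * (φ (suc j) τ - τ))
        ≈⟨ φ-cong r (a-suc j) ⟩
      φ r (φ 1 (a j) * (φ (suc j) τ - φ 1 ϑ))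
        ≈⟨ ^-distrib-* _ _ (q ℕ.^ r) ⟩
      φ r (φ 1 (a j)) * φ r (φ (suc j) τ - φ 1 ϑ)
        ≈⟨ *-cong (φ-φ 1 r (a j)) (trans (φ-sub r _ _) (+-cong (φ-φ (suc j) r τ) (-‿cong (φ-φ 1 r ϑ)))) ⟩
      φ (suc r) (a j) * (φ (suc j ℕ.+ r) τ - φ (suc r) ϑ)
        ≡⟨ ≡.cong (λ v → φ (suc r) (a j) * (φ v τ - φ (suc r) ϑ)) 1+j+r≡m ⟩
      A (suc r) * (φ m τ - φ (suc r) ϑ) ∎
      where
      j = m ∸ suc r

      m∸r≡1+j : m ∸ r ≡ suc j
      m∸r≡1+j = ℕ.+-∸-assoc 1 r<m

      1+j+r≡m : suc j ℕ.+ r ≡ m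
      1+j+r≡m = ≡.trans (≡.sym (ℕ.+-suc j r)) (ℕ.m∸n+n≡m r<m)

    -- In the step, `A-step` replaces `A r (t_m - t_r)` by `A′ (p + (t - θ_(r+1)))` with
    -- `p = t_m - t`. The two multiples of `p` combine to `A′ p s′`, and `S-suc` turns
    -- `s (t - θ_(r+1))` into `s′ (t - t_(r+1))`, so that `A′ s′` factors out.
    telescope : ∀ r → r ≤ m →
      (φ m τ - τ) * ∑ (suc r) (λ i → l i * A i) ≈ A r * S r * (φ m τ - φ r τ)
    telescope zero    _   = begin
      (φ m τ - τ) * (0# + 1# * A 0)
        ≈⟨ solve 2 (λ p x → p :* (con 0 :+ con 1 :* x) := x :* con 1 :* p) refl _ _ ⟩
      A 0 * 1# * (φ m τ - τ)
        ≈⟨ *-cong (*-congˡ S-zero) (+-congˡ (-‿cong (φ-0th τ))) ⟨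
      A 0 * S 0 * (φ m τ - φ 0 τ) ∎
    telescope (suc r) r<m = begin
      p * (∑ (suc r) (λ i → l i * A i) + d * A′)
        ≈⟨ distribˡ _ _ _ ⟩
      p * ∑ (suc r) (λ i → l i * A i) + p * (d * A′)
        ≈⟨ +-congʳ (telescope r (ℕ.<⇒≤ r<m)) ⟩
      A r * s * (φ m τ - φ r τ) + p * (d * A′)
        ≈⟨ +-congʳ (solve 3 (λ x y z → x :* y :* z := y :* (x :* z)) refl (A r) s (φ m τ - φ r τ)) ⟩
      s * (A r * (φ m τ - φ r τ)) + p * (d * A′)
        ≈⟨ +-congʳ (*-congˡ (trans (A-step r r<m) (*-congˡ (x-z≈[x-y]+[y-z] _ τ _)))) ⟩
      s * (A′ * (p + (τ - φ (suc r) ϑ))) + p * (d * A′)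
        ≈⟨ solve 5 (λ s A p v d → s :* (A :* (p :+ v)) :+ p :* (d :* A)
                    := A :* (p :* (d :+ s) :+ s :* v)) refl s A′ p (τ - φ (suc r) ϑ) d ⟩
      A′ * (p * (d + s) + s * (τ - φ (suc r) ϑ))
        ≈⟨ *-congˡ (+-cong (*-congˡ (restore _ _)) (sym (S-suc r))) ⟩
      A′ * (p * s′ + s′ * (τ - φ (suc r) τ))
        ≈⟨ solve 4 (λ A p s w → A :* (p :* s :+ s :* w) := A :* s :* (p :+ w)) refl A′ p s′ _ ⟩
      A′ * s′ * (p + (τ - φ (suc r) τ))
        ≈⟨ *-congˡ (x-z≈[x-y]+[y-z] _ τ _) ⟨
      A′ * s′ * (φ m τ - φ (suc r) τ) ∎
      where
      p  = φ m τ - τ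
      s  = S r
      s′ = S (suc r)
      d  = s′ - s
      A′ = A (suc r)

  -- The telescoped sum at `r = m` has the factor `t_m - t_m`, and `t_m - t` can be cancelled. The
  -- sum is the coefficient of `X^(q^(n+1))` in the logarithm applied to the full exponential.
  log∘exp : ∀ n → ∑ (suc (suc n)) (λ i → l i * φ i (a (suc n ∸ i))) ≈ 0#
  log∘exp n = τ-regular n _ (begin
    _                                         ≈⟨ *-comm _ _ ⟩
    _                                         ≈⟨ telescope (suc n) (suc n) ℕ.≤-refl ⟩
    A (suc n) (suc n) * S (suc n) * (φ (suc n) τ - φ (suc n) τ)
                                              ≈⟨ *-congˡ (-‿inverseʳ _) ⟩
    A (suc n) (suc n) * S (suc n) * 0#        ≈⟨ zeroʳ _ ⟩
    0#                                        ∎)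

-- The truncated exponential and its logarithm

module Exponential {c ℓ} {K : CommutativeRing c ℓ} {q : ℕ} (E : ExpLog K q) (n : ℕ) where
  open CommutativeRing K hiding (zero)
  open ExpLog E
  open LogExp E
  open SeriesFacts K
  open Exp commutativeSemiring using (_^_)
  open Exp S.commutativeSemiring using ()
    renaming (^-distrib-* to ^ₛ-distrib-*)
  open BigOperator +-commutativeMonoid using ()
    renaming (fold to ∑; fold-cong to ∑-cong; fold-ε to ∑-0; fold-truncate to ∑-truncate;
              fold-split-first to ∑-split-first; fold-antidiagonal to ∑-antidiagonal)
  open BigOperator S.+-commutativeMonoid using ()
    renaming (fold-cong to ∑ₛ-cong)
  open RingFacts K using (*-distribˡ-∑; *-distribʳ-∑)
  open Frobenius K q 1<q vanish using (φ; φ-0th)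
  open Frobenius seriesRing q 1<q (series-binomialsVanish K vanish) using ()
    renaming (φ-φ to φₛ-φ; φ-sub to φₛ-sub; φ-∑ to φₛ-∑)
  open GroupProperties +-group using (x∙y⁻¹≈ε⇒x≈y; x≈y⇒x∙y⁻¹≈ε)
  open SetoidReasoning setoid

  q-nonZero : ℕ.NonZero q
  q-nonZero = ℕ.>-nonZero (ℕ.<⇒≤ 1<q)

  q^-mono : ∀ {i j} → i ≤ j → q ℕ.^ i ≤ q ℕ.^ j
  q^-mono i≤j = ℕ.^-monoʳ-≤ q {{q-nonZero}} i≤j

  e : Series
  e = ∑ₛ n (λ i → κ (a i) ⊛ X ^ₛ (q ℕ.^ i))

  e^q^ : ∀ i j → (e ^ₛ (q ℕ.^ i)) j ≈ ∑ n (λ k → φ i (a k) * (X ^ₛ (q ℕ.^ (k ℕ.+ i))) j)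
  e^q^ i j = begin
    (e ^ₛ (q ℕ.^ i)) j
      ≈⟨ φₛ-∑ i n _ j ⟩
    ∑ₛ n (λ k → (κ (a k) ⊛ X ^ₛ (q ℕ.^ k)) ^ₛ (q ℕ.^ i)) j
      ≡⟨ ∑ₛ-coefficient n _ j ⟩
    ∑ n (λ k → ((κ (a k) ⊛ X ^ₛ (q ℕ.^ k)) ^ₛ (q ℕ.^ i)) j)
      ≈⟨ ∑-cong n (λ k _ → term k) ⟩
    ∑ n (λ k → φ i (a k) * (X ^ₛ (q ℕ.^ (k ℕ.+ i))) j) ∎
    where
    term : ∀ k → ((κ (a k) ⊛ X ^ₛ (q ℕ.^ k)) ^ₛ (q ℕ.^ i)) j ≈ φ i (a k) * (X ^ₛ (q ℕ.^ (k ℕ.+ i))) j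
    term k = begin
      ((κ (a k) ⊛ X ^ₛ (q ℕ.^ k)) ^ₛ (q ℕ.^ i)) j
        ≈⟨ ^ₛ-distrib-* (κ (a k)) (X ^ₛ (q ℕ.^ k)) (q ℕ.^ i) j ⟩
      (κ (a k) ^ₛ (q ℕ.^ i) ⊛ (X ^ₛ (q ℕ.^ k)) ^ₛ (q ℕ.^ i)) j
        ≈⟨ S.*-cong {κ (a k) ^ₛ (q ℕ.^ i)} {κ (φ i (a k))} (κ-^ (a k) (q ℕ.^ i)) (φₛ-φ k i X) j ⟩
      (κ (φ i (a k)) ⊛ X ^ₛ (q ℕ.^ (k ℕ.+ i))) j
        ≈⟨ κ-⊛ _ (X ^ₛ (q ℕ.^ (k ℕ.+ i))) j ⟩
      φ i (a k) * (X ^ₛ (q ℕ.^ (k ℕ.+ i))) j ∎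

  -- Additivity of Frobenius lets no mixed terms appear: every exponent of `e^(q^i)` is a single
  -- power of `q`.
  e^q^-sparse : ∀ i → Sparse q 1 (e ^ₛ (q ℕ.^ i))
  e^q^-sparse i j = sparse-≈ (e^q^ i j) (sparse-∑ n λ k _ → term k)
    where
    term : ∀ k → φ i (a k) * (X ^ₛ (q ℕ.^ (k ℕ.+ i))) j ≈ 0# ⊎ PowersSum q 1 j
    term k with sparse-X^ {q} (k ℕ.+ i) j
    ... | inj₁ p = inj₁ (trans (*-congˡ p) (zeroʳ _))
    ... | inj₂ p = inj₂ p

  -- The double sum over `j` and `k` is grouped by `s = j + k`: the coefficient of `X^(q^s)` is
  -- `a 0 = 1` for `s = 0` and zero by `log∘exp` for `s > 0`. Here `t` is an exponent of `X`.
  logarithm : ∀ d → d ≤ n →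
    Vanish (q ℕ.^ d) (∑ₛ d (λ j → κ (l j) ⊛ e ^ₛ (q ℕ.^ j)) ⊕ (⊖ X))
  logarithm d d≤n t t<q^d = x≈y⇒x∙y⁻¹≈ε (begin
    ∑ₛ d (λ j → κ (l j) ⊛ e ^ₛ (q ℕ.^ j)) t
      ≡⟨ ∑ₛ-coefficient d _ t ⟩
    ∑ d (λ j → (κ (l j) ⊛ e ^ₛ (q ℕ.^ j)) t)
      ≈⟨ ∑-cong d (λ j j<d → expand j (ℕ.<⇒≤ j<d)) ⟩
    ∑ d (λ j → ∑ (d ∸ j) (λ k → l j * (φ j (a k) * (X ^ₛ (q ℕ.^ (k ℕ.+ j))) t)))
      ≈⟨ ∑-antidiagonal d _ ⟩
    ∑ d (λ s → ∑ (suc s) (λ j → l j * (φ j (a (s ∸ j)) * (X ^ₛ (q ℕ.^ (s ∸ j ℕ.+ j))) t)))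
      ≈⟨ ∑-cong d (λ s _ → collect s) ⟩
    ∑ d (λ s → ∑ (suc s) (λ j → l j * φ j (a (s ∸ j))) * (X ^ₛ (q ℕ.^ s)) t)
      ≈⟨ total d t<q^d ⟩
    X t ∎)
    where
    expand : ∀ j → j ≤ d → (κ (l j) ⊛ e ^ₛ (q ℕ.^ j)) t
             ≈ ∑ (d ∸ j) (λ k → l j * (φ j (a k) * (X ^ₛ (q ℕ.^ (k ℕ.+ j))) t))
    expand j j≤d = begin
      (κ (l j) ⊛ e ^ₛ (q ℕ.^ j)) t
        ≈⟨ κ-⊛ (l j) (e ^ₛ (q ℕ.^ j)) t ⟩
      l j * (e ^ₛ (q ℕ.^ j)) t
        ≈⟨ *-congˡ (e^q^ j t) ⟩
      l j * ∑ n (λ k → φ j (a k) * (X ^ₛ (q ℕ.^ (k ℕ.+ j))) t)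
        -- For `k ≥ d - j` the exponent `q^(k+j)` is at least `q^d`, hence beyond `t`.
        ≈⟨ *-congˡ (∑-truncate _ (ℕ.≤-trans (ℕ.m∸n≤m d j) d≤n) λ k d∸j≤k →
             trans (*-congˡ (X^-vanish _ t (ℕ.<-≤-trans t<q^d (q^-mono (≡.subst (_≤ k ℕ.+ j) (ℕ.m∸n+n≡m j≤d) (ℕ.+-monoˡ-≤ j d∸j≤k))))))
                   (zeroʳ _)) ⟩
      l j * ∑ (d ∸ j) (λ k → φ j (a k) * (X ^ₛ (q ℕ.^ (k ℕ.+ j))) t)
        ≈⟨ *-distribˡ-∑ (d ∸ j) (l j) _ ⟩
      ∑ (d ∸ j) (λ k → l j * (φ j (a k) * (X ^ₛ (q ℕ.^ (k ℕ.+ j))) t)) ∎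

    collect : ∀ s → ∑ (suc s) (λ j → l j * (φ j (a (s ∸ j)) * (X ^ₛ (q ℕ.^ (s ∸ j ℕ.+ j))) t))
              ≈ ∑ (suc s) (λ j → l j * φ j (a (s ∸ j))) * (X ^ₛ (q ℕ.^ s)) t
    collect s = trans
      (∑-cong (suc s) λ j j≤s → trans (sym (*-assoc _ _ _)) (*-congˡ (reflexive
        (≡.cong (λ m → (X ^ₛ (q ℕ.^ m)) t) (ℕ.m∸n+n≡m (ℕ.s≤s⁻¹ j≤s))))))
      (sym (*-distribʳ-∑ (suc s) _ _))

    total : ∀ d → t < q ℕ.^ d →
      ∑ d (λ s → ∑ (suc s) (λ j → l j * φ j (a (s ∸ j))) * (X ^ₛ (q ℕ.^ s)) t) ≈ X t
    total zero    (s≤s z≤n) = refl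
    total (suc d) _ = begin
      _ ≈⟨ ∑-split-first d _ ⟩
      (0# + 1# * φ 0 (a 0)) * (X ^ₛ 1) t + ∑ d (λ s → ∑ (suc (suc s)) _ * (X ^ₛ (q ℕ.^ suc s)) t)
        ≈⟨ +-cong (*-cong first (S.*-identityʳ X t))
                  (∑-0 d λ s _ → trans (*-congʳ (log∘exp s)) (zeroˡ _)) ⟩
      1# * X t + 0#   ≈⟨ +-identityʳ _ ⟩
      1# * X t        ≈⟨ *-identityˡ _ ⟩
      X t             ∎
      where
      first : 0# + 1# * φ 0 (a 0) ≈ 1#
      first = trans (+-identityˡ _) (trans (*-identityˡ _) (trans (φ-0th _) a-zero))

  -- Frobenius applied to `logarithm` with `n - i` terms: the error, of order `q^(n-i)`, is raised
  -- to the power `q^i` and so has order `q^n`.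
  logarithm^q^ : ∀ i → i ≤ n → ∀ t → t < q ℕ.^ n →
    ∑ₛ (n ∸ i) (λ j → κ (φ i (l j)) ⊛ e ^ₛ (q ℕ.^ (j ℕ.+ i))) t ≈ (X ^ₛ (q ℕ.^ i)) t
  logarithm^q^ i i≤n t t<q^n = begin
    ∑ₛ d (λ j → κ (φ i (l j)) ⊛ e ^ₛ (q ℕ.^ (j ℕ.+ i))) t
      ≈⟨ ∑ₛ-cong d (λ j _ → term j) t ⟨
    ∑ₛ d (λ j → (κ (l j) ⊛ e ^ₛ (q ℕ.^ j)) ^ₛ (q ℕ.^ i)) t
      ≈⟨ φₛ-∑ i d _ t ⟨
    (g ^ₛ (q ℕ.^ i)) t
      ≈⟨ x∙y⁻¹≈ε⇒x≈y _ _ (trans (sym (φₛ-sub i g X t))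
           (vanish-^ (q ℕ.^ d) (q ℕ.^ i) (logarithm d (ℕ.m∸n≤m n i)) t
             (ℕ.<-≤-trans t<q^n (ℕ.≤-reflexive (≡.trans (≡.cong (q ℕ.^_) (≡.sym (ℕ.m+[n∸m]≡n i≤n))) (ℕ.^-distribˡ-+-* q i d)))))) ⟩
    (X ^ₛ (q ℕ.^ i)) t ∎
    where
    d = n ∸ i
    g = ∑ₛ d (λ j → κ (l j) ⊛ e ^ₛ (q ℕ.^ j))

    term : ∀ j → (κ (l j) ⊛ e ^ₛ (q ℕ.^ j)) ^ₛ (q ℕ.^ i) ≋ κ (φ i (l j)) ⊛ e ^ₛ (q ℕ.^ (j ℕ.+ i))
    term j t = trans (^ₛ-distrib-* (κ (l j)) (e ^ₛ (q ℕ.^ j)) (q ℕ.^ i) t)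
      (S.*-cong {κ (l j) ^ₛ (q ℕ.^ i)} {κ (φ i (l j))} (κ-^ (l j) (q ℕ.^ i)) (φₛ-φ j i e) t)

-- The coefficient of `X^N` in polynomials in `e` divided by `1 - e`

module InverseCoefficients {c ℓ} {K : CommutativeRing c ℓ} {q : ℕ} (E : ExpLog K q)
                           (n N : ℕ) (N+1≡q^n : suc N ≡ q ℕ.^ suc n) where
  open CommutativeRing K hiding (zero)
  open ExpLog E
  open LogExp E using (l; ∑l≈S)
  open Exponential E (suc n) using (e; e^q^-sparse; logarithm^q^; q^-mono; q-nonZero)
  open SeriesFacts K
  open Exp commutativeSemiring using (_^_)
  open Exp S.commutativeSemiring using ()
    renaming (^-homo-* to ^ₛ-homo-*; ^-assocʳ to ^ₛ-assocʳ; ^-congʳ to ^ₛ-congʳ)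
  open BigOperator +-commutativeMonoid using ()
    renaming (fold to ∑; fold-cong to ∑-cong; fold-ε to ∑-0; fold-truncate to ∑-truncate;
              fold-split-first to ∑-split-first; fold-single to ∑-single)
  open BigOperator *-commutativeMonoid using () renaming (fold to ∏)
  open BigOperator S.+-commutativeMonoid using ()
    renaming (fold-split-first to ∑ₛ-split-first)
  open BigOperator S.*-commutativeMonoid using () renaming (fold to ∏ₛ; fold-cong to ∏ₛ-cong)
  open RingFacts seriesRing using ()
    renaming (*-distribˡ-∑ to *-distribˡ-∑ₛ; *-distribʳ-∑ to *-distribʳ-∑ₛ; ^-sumℕ to ^ₛ-sumℕ)
  open RingFacts K using (1^n≈1)
  open Frobenius K q 1<q vanish using (φ; φ-cong; φ-∑)
  open CommutativeSemigroupProperties *-commutativeSemigroup using (x∙yz≈y∙xz)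
  open SetoidReasoning setoid

  e-coefficient : ∀ j → e j ≈ ∑ (suc n) (λ i → a i * (X ^ₛ (q ℕ.^ i)) j)
  e-coefficient j = trans (reflexive (∑ₛ-coefficient (suc n) _ j))
    (∑-cong (suc n) λ i _ → κ-⊛ (a i) (X ^ₛ (q ℕ.^ i)) j)

  e-vanish : Vanish 1 e
  e-vanish j j<1 = trans (e-coefficient j) (∑-0 (suc n) λ i _ →
    trans (*-congˡ (X^-vanish (q ℕ.^ i) j (ℕ.<-≤-trans j<1 (q^-mono {0} {i} z≤n)))) (zeroʳ _))

  e-leading : e 1 ≈ 1#
  e-leading = begin
    e 1                                              ≈⟨ e-coefficient 1 ⟩
    ∑ (suc n) (λ i → a i * (X ^ₛ (q ℕ.^ i)) 1)       ≈⟨ ∑-split-first n _ ⟩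
    a 0 * (X ^ₛ 1) 1 + ∑ n (λ i → a (suc i) * (X ^ₛ (q ℕ.^ suc i)) 1)
      ≈⟨ +-cong (*-cong a-zero (S.*-identityʳ X 1)) (∑-0 n λ i _ →
           trans (*-congˡ (X^-vanish (q ℕ.^ suc i) 1 (1<q^ i))) (zeroʳ _)) ⟩
    1# * 1# + 0#                                     ≈⟨ +-identityʳ _ ⟩
    1# * 1#                                          ≈⟨ *-identityʳ 1# ⟩
    1#                                               ∎
    where
    1<q^ : ∀ i → 1 < q ℕ.^ suc i
    1<q^ i = ℕ.<-≤-trans 1<q (ℕ.≤-trans (ℕ.≤-reflexive (≡.sym (ℕ.^-identityʳ q))) (q^-mono {1} {suc i} (s≤s z≤n)))

  e^-beyond : ∀ m → N < m → (e ^ₛ m) N ≈ 0#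
  e^-beyond m N<m = vanish-^ 1 m e-vanish N (≡.subst (N <_) (≡.sym (ℕ.*-identityʳ m)) N<m)

  e^-leading : ∀ m → (e ^ₛ m) m ≈ 1#
  e^-leading m = begin
    (e ^ₛ m) m            ≡⟨ ≡.cong (e ^ₛ m) (≡.sym (ℕ.*-identityʳ m)) ⟩
    (e ^ₛ m) (m ℕ.* 1)    ≈⟨ leading-^ 1 m e-vanish ⟩
    e 1 ^ m               ≈⟨ Exp.^-congˡ commutativeSemiring m e-leading ⟩
    1# ^ m                ≈⟨ 1^n≈1 m ⟩
    1#                    ∎

  p : ℕ
  p = ℕ.pred q

  1+p≡q : suc p ≡ q
  1+p≡q = ℕ.suc-pred q {{q-nonZero}}

  -- w is the sum of the base-q digits of k.
  e^-weight : ∀ d k i → k < q ℕ.^ d → ∃ λ w → w ≤ d ℕ.* p × (w < d ℕ.* p ⊎ suc k ≡ q ℕ.^ d) ×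
    Sparse q w ((e ^ₛ (q ℕ.^ i)) ^ₛ k)
  e^-weight zero    zero i _ = 0 , z≤n , inj₂ ≡.refl , sparse-1
  e^-weight zero    (suc k) i (s≤s ())
  e^-weight (suc d) k i k<q^ with e^-weight d (k ℕ./ q) (suc i) k/q<q^d
    where
    instance _ = q-nonZero
    k/q<q^d : k ℕ./ q < q ℕ.^ d
    k/q<q^d = ℕ.m<n*o⇒m/o<n (≡.subst (k <_) (ℕ.*-comm q (q ℕ.^ d)) k<q^)
  ... | w , w≤ , strict , sparse =
    r ℕ.+ w , ℕ.+-mono-≤ r≤p w≤ , combine strict (ℕ.m≤n⇒m<n∨m≡n r≤p) ,
    λ j → sparse-≈ (sym (decompose j)) (sparse-⊛ (sparse-^ r (e^q^-sparse i)) sparse j)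
    where
    instance _ = q-nonZero
    r = k ℕ.% q
    k′ = k ℕ./ q
    Q = q ℕ.^ i

    k≡ : k ≡ r ℕ.+ q ℕ.* k′
    k≡ = ≡.trans (ℕ.m≡m%n+[m/n]*n k q) (≡.cong (r ℕ.+_) (ℕ.*-comm k′ q))

    r≤p : r ≤ p
    r≤p = ℕ.s≤s⁻¹ (≡.subst (r <_) (≡.sym 1+p≡q) (ℕ.m%n<n k q))

    -- The digit sum attains `suc d * p` only if every digit is `q - 1`, that is only for
    -- `k = q^(d+1) - 1`.
    combine : w < d ℕ.* p ⊎ suc k′ ≡ q ℕ.^ d → r < p ⊎ r ≡ p →
      r ℕ.+ w < suc d ℕ.* p ⊎ suc k ≡ q ℕ.^ suc d
    combine (inj₁ w<) _          = inj₁ (ℕ.+-mono-≤-< r≤p w<)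
    combine (inj₂ _)  (inj₁ r<p) = inj₁ (ℕ.+-mono-<-≤ r<p w≤)
    combine (inj₂ eq) (inj₂ r≡p) = inj₂ (≡.trans (≡.cong suc k≡) (≡.trans
      (≡.cong (λ u → suc u ℕ.+ q ℕ.* k′) r≡p) (≡.trans (≡.cong (ℕ._+ q ℕ.* k′) 1+p≡q)
      (≡.trans (≡.sym (ℕ.*-suc q k′)) (≡.cong (q ℕ.*_) eq)))))

    decompose : (e ^ₛ Q) ^ₛ r ⊛ (e ^ₛ (q ℕ.^ suc i)) ^ₛ k′ ≋ (e ^ₛ Q) ^ₛ k
    decompose j = begin
      ((e ^ₛ Q) ^ₛ r ⊛ (e ^ₛ (q ℕ.^ suc i)) ^ₛ k′) j
        ≡⟨ ≡.cong (λ u → ((e ^ₛ Q) ^ₛ r ⊛ (e ^ₛ u) ^ₛ k′) j) (ℕ.*-comm q Q) ⟩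
      ((e ^ₛ Q) ^ₛ r ⊛ (e ^ₛ (Q ℕ.* q)) ^ₛ k′) j
        ≈⟨ S.*-congˡ {(e ^ₛ Q) ^ₛ r} (S.trans
             (Exp.^-congˡ S.commutativeSemiring k′ (S.sym (^ₛ-assocʳ e Q q))) (^ₛ-assocʳ (e ^ₛ Q) q k′)) j ⟩
      ((e ^ₛ Q) ^ₛ r ⊛ (e ^ₛ Q) ^ₛ (q ℕ.* k′)) j
        ≈⟨ ^ₛ-homo-* (e ^ₛ Q) r (q ℕ.* k′) j ⟨
      ((e ^ₛ Q) ^ₛ (r ℕ.+ q ℕ.* k′)) j
        ≡⟨ ≡.cong (λ u → ((e ^ₛ Q) ^ₛ u) j) (≡.sym k≡) ⟩
      ((e ^ₛ Q) ^ₛ k) j ∎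

  -- A number `m` below `N` has digit sum less than `suc n * p`, while `N` is no sum of so few
  -- powers of `q`.
  e^-below : ∀ m → m < N → (e ^ₛ m) N ≈ 0#
  e^-below m m<N with e^-weight (suc n) m 0 (≡.subst (m <_) N+1≡q^n (ℕ.m<n⇒m<1+n m<N))
  ... | w , _ , inj₂ eq , _ = ⊥-elim (ℕ.<-irrefl (ℕ.suc-injective (≡.trans eq (≡.sym N+1≡q^n))) m<N)
  ... | w , _ , inj₁ w<  , sparse with sparse N
  ...   | inj₁ z = trans (Exp.^-congˡ S.commutativeSemiring m (S.sym (S.*-identityʳ e)) N) z
  ...   | inj₂ s = ⊥-elim (ℕ.<⇒≱ w< (powersSum-bound p (suc n)
            (≡.trans N+1≡q^n (≡.cong (ℕ._^ suc n) (≡.sym 1+p≡q)))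
            (≡.subst (λ u → PowersSum u w N) (≡.sym 1+p≡q) s)))

  -- The geometric series for `1 / (1 - e)`, cut where `e^r` no longer reaches exponents up to `N`.
  F : Series
  F = ∑ₛ (suc N) (e ^ₛ_)

  -- From `F + e^(N+1) = 1 + e F`, where `e^(N+1)` has order above `k`. The range of the sum is
  -- adapted to the recursion of `cAux`.
  F-recursion : ∀ k → k ≤ N → F k ≈ 𝟙 k + ∑ (suc k) (λ i → a i * (X ^ₛ (q ℕ.^ i) ⊛ F) k)
  F-recursion k k≤N = begin
    F k                              ≈⟨ +-identityʳ _ ⟨
    F k + 0#                         ≈⟨ +-congˡ (vanish-^ 1 (suc N) e-vanish k
                                          (≡.subst (k <_) (≡.sym (ℕ.*-identityʳ (suc N))) (s≤s k≤N))) ⟨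
    ∑ₛ (suc (suc N)) (e ^ₛ_) k       ≈⟨ ∑ₛ-split-first (suc N) (e ^ₛ_) k ⟩
    𝟙 k + ∑ₛ (suc N) (λ r → e ⊛ e ^ₛ r) k
                                     ≈⟨ +-congˡ (*-distribˡ-∑ₛ (suc N) e (e ^ₛ_) k) ⟨
    𝟙 k + (e ⊛ F) k                  ≈⟨ +-congˡ (*-distribʳ-∑ₛ (suc n) F _ k) ⟩
    𝟙 k + ∑ₛ (suc n) (λ i → κ (a i) ⊛ X ^ₛ (q ℕ.^ i) ⊛ F) k
                                     ≡⟨ ≡.cong (𝟙 k +_) (∑ₛ-coefficient (suc n) _ k) ⟩
    𝟙 k + ∑ (suc n) (λ i → (κ (a i) ⊛ X ^ₛ (q ℕ.^ i) ⊛ F) k)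
                                     ≈⟨ +-congˡ (∑-cong (suc n) λ i _ → trans (⊛-assoc (κ (a i)) _ F k)
                                          (κ-⊛ (a i) (X ^ₛ (q ℕ.^ i) ⊛ F) k)) ⟩
    -- All terms with `q^i > k` vanish, so both ranges are compared with a common longer one.
    𝟙 k + ∑ (suc n) term             ≈⟨ +-congˡ (∑-truncate term (ℕ.m≤m+n (suc n) (suc k)) beyond-n) ⟨
    𝟙 k + ∑ (suc n ℕ.+ suc k) term   ≈⟨ +-congˡ (∑-truncate term (ℕ.m≤n+m (suc k) (suc n)) beyond-k) ⟩
    𝟙 k + ∑ (suc k) term             ∎
    where
    term : ℕ → Carrier
    term i = a i * (X ^ₛ (q ℕ.^ i) ⊛ F) k

    term-0 : ∀ i → k < q ℕ.^ i → term i ≈ 0#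
    term-0 i k<q^i = trans (*-congˡ (X^-⊛-vanish (q ℕ.^ i) F k k<q^i)) (zeroʳ _)

    beyond-n : ∀ i → suc n ≤ i → term i ≈ 0#
    beyond-n i n<i = term-0 i (ℕ.≤-trans (s≤s k≤N) (≡.subst (_≤ q ℕ.^ i) (≡.sym N+1≡q^n) (q^-mono n<i)))

    beyond-k : ∀ i → suc k ≤ i → term i ≈ 0#
    beyond-k i k<i = term-0 i (ℕ.<-trans k<i (i<q^ i))
      where
      i<q^ : ∀ i → i < q ℕ.^ i
      i<q^ zero    = s≤s z≤n
      i<q^ (suc i) = ℕ.≤-<-trans (i<q^ i) (ℕ.^-monoʳ-< q 1<q (ℕ.n<1+n i))

  -- Among the powers `e^(r+k)` only the one with `r + k = N` has a nonzero coefficient at `N`; the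
  -- bound on `k` ensures that it occurs in the sum.
  F⊛e^ : ∀ k → k ≤ N → (F ⊛ e ^ₛ k) N ≈ 1#
  F⊛e^ k k≤N = begin
    (F ⊛ e ^ₛ k) N                              ≈⟨ *-distribʳ-∑ₛ (suc N) (e ^ₛ k) (e ^ₛ_) N ⟩
    ∑ₛ (suc N) (λ r → e ^ₛ r ⊛ e ^ₛ k) N        ≡⟨ ∑ₛ-coefficient (suc N) _ N ⟩
    ∑ (suc N) (λ r → (e ^ₛ r ⊛ e ^ₛ k) N)       ≈⟨ ∑-cong (suc N) (λ r _ → ^ₛ-homo-* e r k N) ⟨
    ∑ (suc N) (λ r → (e ^ₛ (r ℕ.+ k)) N)        ≈⟨ ∑-single (suc N) _ (s≤s (ℕ.m∸n≤m N k)) other ⟩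
    (e ^ₛ (N ∸ k ℕ.+ k)) N                      ≡⟨ ≡.cong (λ m → (e ^ₛ m) N) (ℕ.m∸n+n≡m k≤N) ⟩
    (e ^ₛ N) N                                  ≈⟨ e^-leading N ⟩
    1#                                          ∎
    where
    other : ∀ r → r < suc N → r ≢ N ∸ k → (e ^ₛ (r ℕ.+ k)) N ≈ 0#
    other r _ r≢ with ℕ.<-cmp (r ℕ.+ k) N
    ... | tri< lt _ _ = e^-below _ lt
    ... | tri≈ _ eq _ = ⊥-elim (r≢ (≡.trans (≡.sym (ℕ.m+n∸n≡m r k)) (≡.cong (_∸ k) eq)))
    ... | tri> _ _ gt = e^-beyond _ gt

  -- InE d f v: modulo X ^ (N + 1), f is a polynomial in e of degree at most d
  -- which takes the value v at e = 1.
  data InE (d : ℕ) : Series → Carrier → Set (c ⊔ ℓ) where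
    power : ∀ {k} → k ≤ d → InE d (e ^ₛ k) 1#
    plus  : ∀ {f g u v} → InE d f u → InE d g v → InE d (f ⊕ g) (u + v)
    scale : ∀ x {f u} → InE d f u → InE d (κ x ⊛ f) (x * u)
    resp  : ∀ {f g u v} → (∀ j → j ≤ N → f j ≈ g j) → u ≈ v → InE d f u → InE d g v

  -- The coefficient of `F f` at `N` is linear in `f` and equals 1 on every `e^k` with `k ≤ N`, just
  -- as evaluation at `e = 1` does.
  inE-value : ∀ {d f v} → d ≤ N → InE d f v → (F ⊛ f) N ≈ v
  inE-value d≤N (power k≤d) = F⊛e^ _ (ℕ.≤-trans k≤d d≤N)
  inE-value d≤N (plus {f} {g} p r) = trans (⊛-distribˡ F f g N) (+-cong (inE-value d≤N p) (inE-value d≤N r))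
  inE-value d≤N (scale x {f} {u} p) = begin
    (F ⊛ (κ x ⊛ f)) N     ≈⟨ ⊛-assoc F (κ x) f N ⟨
    (F ⊛ κ x ⊛ f) N       ≈⟨ S.*-congʳ {f} (⊛-comm F (κ x)) N ⟩
    (κ x ⊛ F ⊛ f) N       ≈⟨ ⊛-assoc (κ x) F f N ⟩
    (κ x ⊛ (F ⊛ f)) N     ≈⟨ κ-⊛ x (F ⊛ f) N ⟩
    x * (F ⊛ f) N         ≈⟨ *-congˡ (inE-value d≤N p) ⟩
    x * u                 ∎
  inE-value d≤N (resp f≈g u≈v p) =
    trans (sym (⊛-cong-≤ N (λ _ _ → refl) f≈g N ℕ.≤-refl)) (trans (inE-value d≤N p) u≈v)

  -- Induction first on the left and then on the right factor reduces to `e^k e^k′ = e^(k+k′)`;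
  -- degrees add and values multiply.
  inE-⊛ : ∀ {d d′ f g u v} → InE d f u → InE d′ g v → InE (d ℕ.+ d′) (f ⊛ g) (u * v)
  inE-⊛ (power {k} k≤d) (power {k′} k′≤d′) =
    resp (λ j _ → ^ₛ-homo-* e k k′ j) (sym (*-identityʳ 1#)) (power (ℕ.+-mono-≤ k≤d k′≤d′))
  inE-⊛ p@(power _) (plus r s) =
    resp (λ j _ → sym (⊛-distribˡ _ _ _ j)) (sym (distribˡ _ _ _)) (plus (inE-⊛ p r) (inE-⊛ p s))
  inE-⊛ {g = g} p@(power {k} _) (scale x {f} r) =
    resp (λ j _ → trans (sym (⊛-assoc (κ x) (e ^ₛ k) f j))
           (trans (S.*-congʳ {f} (⊛-comm (κ x) (e ^ₛ k)) j) (⊛-assoc (e ^ₛ k) (κ x) f j)))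
         (x∙yz≈y∙xz _ _ _) (scale x (inE-⊛ p r))
  inE-⊛ p@(power _) (resp f≈g u≈v r) =
    resp (⊛-cong-≤ N (λ _ _ → refl) f≈g) (*-congˡ u≈v) (inE-⊛ p r)
  inE-⊛ (plus p r) s = resp (λ j _ → sym (⊛-distribʳ _ _ _ j)) (sym (distribʳ _ _ _)) (plus (inE-⊛ p s) (inE-⊛ r s))
  inE-⊛ {g = g} (scale x {f} p) r = resp (λ j _ → sym (⊛-assoc (κ x) f g j)) (sym (*-assoc _ _ _)) (scale x (inE-⊛ p r))
  inE-⊛ (resp f≈g u≈v p) r = resp (⊛-cong-≤ N f≈g (λ _ _ → refl)) (*-congʳ u≈v) (inE-⊛ p r)

  inE-∑ : ∀ {d} m {f u} → (∀ i → i < m → InE d (f i) (u i)) → InE d (∑ₛ m f) (∑ m u)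
  -- The empty sum is encoded as `0 * e^0`, since no constructor of `InE` gives the zero series
  -- directly.
  inE-∑ zero    p = resp (λ j _ → trans (κ-⊛ 0# 𝟙 j) (zeroˡ _)) (zeroˡ 1#) (scale 0# (power {k = 0} z≤n))
  inE-∑ (suc m) p = plus (inE-∑ m λ i i<m → p i (ℕ.m<n⇒m<1+n i<m)) (p m ℕ.≤-refl)

  inE-^ : ∀ {d f u} m → InE d f u → InE (m ℕ.* d) (f ^ₛ m) (u ^ m)
  inE-^ zero    p = power z≤n
  inE-^ (suc m) p = inE-⊛ p (inE-^ m p)

  inE-∏ : ∀ {d} m (ν : ℕ → ℕ) {f : ℕ → Series} {u : ℕ → Carrier} → (∀ i → i < m → InE d (f i) (u i)) →
    InE (sumℕ m ν ℕ.* d) (∏ₛ m (λ i → f i ^ₛ ν i)) (∏ m (λ i → u i ^ ν i))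
  inE-∏ zero    ν p = power z≤n
  inE-∏ {d} (suc m) ν {f} {u} p =
    ≡.subst (λ b → InE b (∏ₛ (suc m) (λ i → f i ^ₛ ν i)) (∏ (suc m) (λ i → u i ^ ν i)))
      (≡.sym (ℕ.*-distribʳ-+ d (sumℕ m ν) (ν m)))
      (inE-⊛ (inE-∏ m ν λ i i<m → p i (ℕ.m<n⇒m<1+n i<m)) (inE-^ (ν m) (p m ℕ.≤-refl)))

  -- The truncated logarithm writes `X^(q^i)` with the powers `e^(q^(j+i))`, `j + i ≤ n`. At `e = 1`
  -- its coefficients add up to the twist of a partial sum of `l`.
  inE-X^ : ∀ i → i < suc n → InE (q ℕ.^ n) (X ^ₛ (q ℕ.^ i)) (φ i (S (n ∸ i)))
  inE-X^ i (s≤s i≤n) = resp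
    (λ j j≤N → logarithm^q^ i (ℕ.m≤n⇒m≤1+n i≤n) j (≡.subst (j <_) N+1≡q^n (s≤s j≤N)))
    (begin
      ∑ (suc n ∸ i) (λ j → φ i (l j) * 1#)   ≈⟨ ∑-cong (suc n ∸ i) (λ j _ → *-identityʳ _) ⟩
      ∑ (suc n ∸ i) (λ j → φ i (l j))        ≈⟨ φ-∑ i (suc n ∸ i) l ⟨
      φ i (∑ (suc n ∸ i) l)                  ≡⟨ ≡.cong (λ m → φ i (∑ m l)) (ℕ.+-∸-assoc 1 i≤n) ⟩
      φ i (∑ (suc (n ∸ i)) l)                ≈⟨ φ-cong i (∑l≈S (n ∸ i)) ⟩
      φ i (S (n ∸ i))                        ∎)
    (inE-∑ (suc n ∸ i) λ j j< → scale _ (power (q^-mono (bound j j<))))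
    where
    bound : ∀ j → j < suc n ∸ i → j ℕ.+ i ≤ n
    bound j j< = ℕ.≤-trans (ℕ.+-monoˡ-≤ i (ℕ.s≤s⁻¹ (≡.subst (j <_) (ℕ.+-∸-assoc 1 i≤n) j<)))
                   (ℕ.≤-reflexive (ℕ.m∸n+n≡m i≤n))

  module _ (ν : ℕ → ℕ) (∑ν<q : sumℕ (suc n) ν < q) where
    total : ℕ
    total = sumℕ (suc n) (λ i → ν i ℕ.* q ℕ.^ i)

    -- Each `X^(q^i)` has degree at most `q^n` in `e`; fewer than `q` such factors stay below
    -- `q^(n+1) = N + 1`.
    degree≤N : sumℕ (suc n) ν ℕ.* q ℕ.^ n ≤ N
    degree≤N = ℕ.s≤s⁻¹ (≡.subst (sumℕ (suc n) ν ℕ.* q ℕ.^ n <_) (≡.sym N+1≡q^n)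
      (ℕ.*-monoˡ-< (q ℕ.^ n) {{ℕ.m^n≢0 q n {{q-nonZero}}}} ∑ν<q))

    total≤N : total ≤ N
    total≤N = ℕ.≤-trans (go (suc n) ℕ.≤-refl) degree≤N
      where
      go : ∀ m → m ≤ suc n → sumℕ m (λ i → ν i ℕ.* q ℕ.^ i) ≤ sumℕ m ν ℕ.* q ℕ.^ n
      go zero    _   = z≤n
      go (suc m) m<n = ℕ.≤-trans
        (ℕ.+-mono-≤ (go m (ℕ.<⇒≤ m<n)) (ℕ.*-monoʳ-≤ (ν m) (q^-mono (ℕ.s≤s⁻¹ m<n))))
        (ℕ.≤-reflexive (≡.sym (ℕ.*-distribʳ-+ (q ℕ.^ n) (sumℕ m ν) (ν m))))

    -- Multiplication by `X^total` moves the wanted coefficient to index `N`, where `inE-value`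
    -- computes it.
    F-value : F (N ∸ total) ≈ ∏ (suc n) (λ i → φ i (S (n ∸ i)) ^ ν i)
    F-value = begin
      F (N ∸ total)                              ≈⟨ X^-shift total F (N ∸ total) ⟨
      (X ^ₛ total ⊛ F) (total ℕ.+ (N ∸ total))   ≡⟨ ≡.cong (X ^ₛ total ⊛ F) (ℕ.m+[n∸m]≡n total≤N) ⟩
      (X ^ₛ total ⊛ F) N                         ≈⟨ ⊛-comm (X ^ₛ total) F N ⟩
      (F ⊛ X ^ₛ total) N                         ≈⟨ S.*-congˡ {F} X^total N ⟩
      (F ⊛ ∏ₛ (suc n) (λ i → (X ^ₛ (q ℕ.^ i)) ^ₛ ν i)) N
        ≈⟨ inE-value degree≤N (inE-∏ (suc n) ν inE-X^) ⟩
      ∏ (suc n) (λ i → φ i (S (n ∸ i)) ^ ν i)    ∎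
      where
      X^total : X ^ₛ total ≋ ∏ₛ (suc n) (λ i → (X ^ₛ (q ℕ.^ i)) ^ₛ ν i)
      X^total = S.trans (^ₛ-sumℕ X (suc n) _) (∏ₛ-cong (suc n) λ i _ → S.trans
        (^ₛ-congʳ X (ℕ.*-comm (ν i) (q ℕ.^ i))) (S.sym (^ₛ-assocʳ X (q ℕ.^ i) (ν i))))

-- The coefficients G_i / D_i|_{θ=t}

module AndersonThakur {c ℓ} (R : CommutativeRing c ℓ) (q : ℕ) (1<q : 1 < q) (vanish : BinomialsVanish R q)
  (t θ : CommutativeRing.Carrier R)
  (t-regular : ∀ k → Fractions.Regular R (CommutativeRing._-_ R (Frobenius.φ R q 1<q vanish (suc k) t) t)) where
  open CommutativeRing R hiding (zero)
  open Fractions R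
  open Exp commutativeSemiring using (_^_; ^-distrib-*; ^-congˡ; ^-congʳ; ^-assocʳ)
  open BigOperator *-commutativeMonoid using ()
    renaming (fold to ∏; fold-cong to ∏-cong; fold-∙ to ∏-*; fold-split-first to ∏-split-first;
              fold-triangle-swap to ∏-triangle-swap)
  open RingFacts R using (∏-^; ^-sumℕ)
  open Frobenius R q 1<q vanish using (φ; φ-0th; φ-φ; φ-sub)
  open RingProperties ring using (-1*x≈-x)
  open AbelianGroupProperties +-abelianGroup using (⁻¹-anti-homo‿-)
  open SetoidReasoning setoid
  private
    module K = CommutativeRing fractionRing
    module Solver = SemiringSolver commutativeSemiring
  open Solver using (solve; _:*_; _:=_; con)
  open Exp K.commutativeSemiring using ()
    renaming (_^_ to _^ₖ_; ^-congˡ to ^ₖ-congˡ; ^-congʳ to ^ₖ-congʳ; ^-assocʳ to ^ₖ-assocʳ)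
  open BigOperator K.*-commutativeMonoid using () renaming (fold to ∏ₖ; fold-cong to ∏ₖ-cong)
  module KReasoning = SetoidReasoning K.setoid

  G D L P : ℕ → Carrier
  G i = ∏ i (λ j → φ i t - φ (suc j) θ)
  D k = ∏ k (λ i → φ k t - φ i t)
  L k = ∏ k (λ j → φ (suc j) t - t)
  P d = ∏ d (λ k → t - φ (suc k) θ)

  -- One identity for two recursions: `y = θ`, `s = 1` gives that of `G`, and `y = t`, `s = 0` that
  -- of `D`. All factors but the first are `q`-th powers of those one level lower.
  twist : ∀ x y s j →
    ∏ (suc j) (λ i → φ (suc j) x - φ (i ℕ.+ s) y)
    ≈ (φ (suc j) x - φ s y) * φ 1 (∏ j (λ i → φ j x - φ (i ℕ.+ s) y))
  twist x y s j = begin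
    ∏ (suc j) (λ i → φ (suc j) x - φ (i ℕ.+ s) y)
      ≈⟨ ∏-split-first j _ ⟩
    (φ (suc j) x - φ s y) * ∏ j (λ i → φ (suc j) x - φ (suc i ℕ.+ s) y)
      ≈⟨ *-congˡ (∏-cong j λ i _ → factor i) ⟩
    (φ (suc j) x - φ s y) * ∏ j (λ i → φ 1 (φ j x - φ (i ℕ.+ s) y))
      ≈⟨ *-congˡ (∏-^ j _ (q ℕ.^ 1)) ⟨
    (φ (suc j) x - φ s y) * φ 1 (∏ j (λ i → φ j x - φ (i ℕ.+ s) y)) ∎
    where
    step : ∀ m z → φ (suc m) z ≈ φ 1 (φ m z)
    step m z = trans (^-congʳ z (≡.cong (q ℕ.^_) (≡.sym (ℕ.+-comm m 1)))) (sym (φ-φ m 1 z))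

    factor : ∀ i → φ (suc j) x - φ (suc i ℕ.+ s) y ≈ φ 1 (φ j x - φ (i ℕ.+ s) y)
    factor i = trans (+-cong (step j x) (-‿cong (step (i ℕ.+ s) y))) (sym (φ-sub 1 _ _))

  G-suc : ∀ j → G (suc j) ≈ (φ (suc j) t - φ 1 θ) * φ 1 (G j)
  G-suc j = begin
    G (suc j)
      ≈⟨ ∏-cong (suc j) (λ i _ → reindex (suc j) i) ⟩
    ∏ (suc j) (λ i → φ (suc j) t - φ (i ℕ.+ 1) θ)
      ≈⟨ twist t θ 1 j ⟩
    (φ (suc j) t - φ 1 θ) * φ 1 (∏ j (λ i → φ j t - φ (i ℕ.+ 1) θ))
      ≈⟨ *-congˡ (^-congˡ (q ℕ.^ 1) (∏-cong j λ i _ → reindex j i)) ⟨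
    (φ (suc j) t - φ 1 θ) * φ 1 (G j) ∎
    where
    reindex : ∀ j i → φ j t - φ (suc i) θ ≈ φ j t - φ (i ℕ.+ 1) θ
    reindex j i = reflexive (≡.cong (λ m → φ j t - φ m θ) (ℕ.+-comm 1 i))

  D-suc : ∀ j → D (suc j) ≈ (φ (suc j) t - t) * φ 1 (D j)
  D-suc j = begin
    D (suc j)
      ≈⟨ ∏-cong (suc j) (λ i _ → reindex (suc j) i) ⟩
    ∏ (suc j) (λ i → φ (suc j) t - φ (i ℕ.+ 0) t)
      ≈⟨ twist t t 0 j ⟩
    (φ (suc j) t - φ 0 t) * φ 1 (∏ j (λ i → φ j t - φ (i ℕ.+ 0) t))
      ≈⟨ *-cong (+-congˡ (-‿cong (sym (φ-0th t)))) (^-congˡ (q ℕ.^ 1) (∏-cong j λ i _ → reindex j i)) ⟨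
    (φ (suc j) t - t) * φ 1 (D j) ∎
    where
    reindex : ∀ j i → φ j t - φ i t ≈ φ j t - φ (i ℕ.+ 0) t
    reindex j i = reflexive (≡.cong (λ m → φ j t - φ m t) (≡.sym (ℕ.+-identityʳ i)))

  -- The recursion of `D` reduces its factors `t^(q^k) - t^(q^i)` to the differences covered by
  -- `t-regular`.
  D-regular : ∀ k → Regular (D k)
  D-regular zero    = regular-1
  D-regular (suc k) = regular-≈ (sym (D-suc k)) (regular-* (t-regular k) (regular-^ (q ℕ.^ 1) (D-regular k)))

  L-regular : ∀ k → Regular (L k)
  L-regular k = regular-∏ k t-regular

  embed-sub : ∀ x y → embed x K.- embed y K.≈ embed (x - y)
  embed-sub x y = embed-+ x (- y)

  embed-φ-sub : ∀ i j x y → embed x ^ₖ (q ℕ.^ i) K.- embed y ^ₖ (q ℕ.^ j) K.≈ embed (φ i x - φ j y)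
  embed-φ-sub i j x y = K.trans
    (K.+-cong (embed-^ x (q ℕ.^ i)) (K.-‿cong (embed-^ y (q ℕ.^ j)))) (embed-sub _ _)

  expLog : ExpLog fractionRing q
  expLog = record
    { 1<q       = 1<q
    ; vanish    = fraction-binomialsVanish R vanish
    ; τ         = embed t
    ; ϑ         = embed θ
    ; τ-regular = τ-regular
    ; a         = a
    ; S         = S
    ; a-zero    = K.refl
    ; a-suc     = a-suc
    ; S-zero    = by (*-congʳ (*-identityʳ 1#))
    ; S-suc     = S-suc
    }
    where
    a S : ℕ → Fraction
    a i = mk (G i) (D i) (D-regular i)
    -- The sign converts the product of the `t_k - t` in `L d` into that of the `t - t_k`.
    S d = mk ((- 1#) ^ d * P d) (L d) (L-regular d)

    left : ∀ i → embed t ^ₖ (q ℕ.^ i) K.- embed t K.≈ embed (φ i t - t)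
    left i = K.trans (K.+-congʳ (embed-^ t (q ℕ.^ i))) (embed-sub _ _)

    right : ∀ i x → embed t K.- embed x ^ₖ (q ℕ.^ i) K.≈ embed (t - φ i x)
    right i x = K.trans (K.+-congˡ (K.-‿cong (embed-^ x (q ℕ.^ i)))) (embed-sub _ _)

    τ-regular : ∀ n x → x K.* (embed t ^ₖ (q ℕ.^ suc n) K.- embed t) K.≈ K.0# → x K.≈ K.0#
    τ-regular n x eq = by (trans (*-identityʳ _) (trans num≈0 (sym (zeroˡ _))))
      where
      cleared : x K.* embed (φ (suc n) t - t) K.≈ K.0#
      cleared = K.trans (K.*-congˡ (K.sym (left (suc n)))) eq

      num≈0 : num x ≈ 0#
      num≈0 = t-regular n (num x) (trans (sym (*-identityʳ _)) (trans (cross cleared) (zeroˡ _)))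

    a-suc : ∀ j → a (suc j) K.* (embed t ^ₖ (q ℕ.^ suc j) K.- embed t)
              K.≈ a j ^ₖ (q ℕ.^ 1) K.* (embed t ^ₖ (q ℕ.^ suc j) K.- embed θ ^ₖ (q ℕ.^ 1))
    a-suc j = K.trans (K.*-congˡ (left (suc j))) (K.trans (by (begin
      G (suc j) * x * (φ 1 (D j) * 1#)          ≈⟨ *-congʳ (*-congʳ (G-suc j)) ⟩
      y * φ 1 (G j) * x * (φ 1 (D j) * 1#)
        ≈⟨ solve 4 (λ y g x d → y :* g :* x :* (d :* con 1) := g :* y :* (x :* d :* con 1)) refl y (φ 1 (G j)) x (φ 1 (D j)) ⟩
      φ 1 (G j) * y * (x * φ 1 (D j) * 1#)      ≈⟨ *-congˡ (*-congʳ (D-suc j)) ⟨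
      φ 1 (G j) * y * (D (suc j) * 1#)          ∎))
      (K.sym (K.*-cong (mk-^ (D-regular j) (q ℕ.^ 1)) (embed-φ-sub (suc j) 1 t θ))))
      where
      x = φ (suc j) t - t
      y = φ (suc j) t - φ 1 θ

    S-suc : ∀ d → S (suc d) K.* (embed t K.- embed t ^ₖ (q ℕ.^ suc d))
              K.≈ S d K.* (embed t K.- embed θ ^ₖ (q ℕ.^ suc d))
    S-suc d = K.trans (K.*-congˡ (right (suc d) t)) (K.trans (by (begin
      (- 1# * s * (P d * y)) * x * (L d * 1#)
        ≈⟨ solve 6 (λ n s p y x l → (n :* s :* (p :* y)) :* x :* (l :* con 1)
                    := s :* p :* y :* (l :* (n :* x) :* con 1)) refl (- 1#) s (P d) y x (L d) ⟩
      s * P d * y * (L d * (- 1# * x) * 1#)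
        ≈⟨ *-congˡ (*-congʳ (*-congˡ (trans (-1*x≈-x x) (⁻¹-anti-homo‿- t (φ (suc d) t))))) ⟩
      s * P d * y * (L d * (φ (suc d) t - t) * 1#) ∎))
      (K.sym (K.*-congˡ (right (suc d) θ))))
      where
      s = (- 1#) ^ d
      x = t - φ (suc d) t
      y = t - φ (suc d) θ

  open ExpLog expLog using (a; S; S-zero) public

  -- The link to bare pairs: the second component is shown regular together with the equality, since
  -- the pair itself records nothing about it.
  Represents : Carrier × Carrier → Fraction → Set (c ⊔ ℓ)
  Represents (u , v) κ = Σ[ r ∈ Regular v ] (mk u v r ≃ κ)

  represents-≈ : ∀ {uv κ κ′} → κ ≃ κ′ → Represents uv κ → Represents uv κ′
  represents-≈ κ≈κ′ (r , p) = r , K.trans p κ≈κ′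

  represents-0 : Represents (0# , 1#) K.0#
  represents-0 = regular-1 , by refl

  represents-1 : Represents (1# , 1#) K.1#
  represents-1 = regular-1 , by refl

  represents-a : ∀ i → Represents (G i , D i) (a i)
  represents-a i = D-regular i , by refl

  represents-+ : ∀ {u v u′ v′ κ κ′} → Represents (u , v) κ → Represents (u′ , v′) κ′ →
    Represents (u * v′ + u′ * v , v * v′) (κ K.+ κ′)
  represents-+ (r , p) (r′ , p′) = regular-* r r′ , by (cross (K.+-cong p p′))

  represents-* : ∀ {u v u′ v′ κ κ′} → Represents (u , v) κ → Represents (u′ , v′) κ′ →
    Represents (u * u′ , v * v′) (κ K.* κ′)
  represents-* (r , p) (r′ , p′) = regular-* r r′ , by (cross (K.*-cong p p′))

  module _ (n : ℕ) (ν : ℕ → ℕ) where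
    ε : ℕ → ℕ
    ε i = ν i ℕ.* q ℕ.^ i

    numerator denominator : Carrier
    numerator   = (- 1#) ^ sumℕ n (λ i → (n ∸ i) ℕ.* ν i ℕ.* q ℕ.^ i)
                  * ∏ n (λ k → (t - θ ^ (q ℕ.^ (k ℕ.+ 1))) ^ sumℕ (suc n ∸ (k ℕ.+ 1)) ε)
    denominator = ∏ n (λ i → L (n ∸ i) ^ ε i)

    numerator-∏ : ∏ n (λ i → ((- 1#) ^ (n ∸ i) * P (n ∸ i)) ^ ε i) ≈ numerator
    numerator-∏ = begin
      ∏ n (λ i → ((- 1#) ^ (n ∸ i) * P (n ∸ i)) ^ ε i)
        ≈⟨ ∏-cong n (λ i _ → ^-distrib-* _ _ (ε i)) ⟩
      ∏ n (λ i → ((- 1#) ^ (n ∸ i)) ^ ε i * P (n ∸ i) ^ ε i)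
        ≈⟨ ∏-* n _ _ ⟩
      ∏ n (λ i → ((- 1#) ^ (n ∸ i)) ^ ε i) * ∏ n (λ i → P (n ∸ i) ^ ε i)
        ≈⟨ *-cong sign product ⟩
      numerator ∎
      where
      sign : ∏ n (λ i → ((- 1#) ^ (n ∸ i)) ^ ε i) ≈ (- 1#) ^ sumℕ n (λ i → (n ∸ i) ℕ.* ν i ℕ.* q ℕ.^ i)
      sign = trans
        (∏-cong n λ i _ → trans (^-assocʳ (- 1#) (n ∸ i) (ε i))
          (^-congʳ (- 1#) (≡.sym (ℕ.*-assoc (n ∸ i) (ν i) (q ℕ.^ i)))))
        (sym (^-sumℕ (- 1#) n _))

      -- The pairs with `i + k < n` are reordered by `k`, which gathers all powers of one
      -- `t - θ^(q^(k+1))`; their exponents add up to the partial sum of `ε`.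
      product : ∏ n (λ i → P (n ∸ i) ^ ε i)
                ≈ ∏ n (λ k → (t - θ ^ (q ℕ.^ (k ℕ.+ 1))) ^ sumℕ (suc n ∸ (k ℕ.+ 1)) ε)
      product = begin
        ∏ n (λ i → P (n ∸ i) ^ ε i)
          ≈⟨ ∏-cong n (λ i _ → ∏-^ (n ∸ i) _ (ε i)) ⟩
        ∏ n (λ i → ∏ (n ∸ i) (λ k → (t - φ (suc k) θ) ^ ε i))
          ≈⟨ ∏-triangle-swap n _ ⟩
        ∏ n (λ k → ∏ (n ∸ k) (λ i → (t - φ (suc k) θ) ^ ε i))
          ≈⟨ ∏-cong n (λ k _ → ^-sumℕ (t - φ (suc k) θ) (n ∸ k) ε) ⟨
        ∏ n (λ k → (t - φ (suc k) θ) ^ sumℕ (n ∸ k) ε)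
          ≈⟨ ∏-cong n (λ k _ → reflexive (≡.cong (λ m → (t - φ m θ) ^ sumℕ (suc n ∸ m) ε) (ℕ.+-comm 1 k))) ⟩
        ∏ n (λ k → (t - θ ^ (q ℕ.^ (k ℕ.+ 1))) ^ sumℕ (suc n ∸ (k ℕ.+ 1)) ε) ∎

    ∏S : ∏ₖ (suc n) (λ i → (S (n ∸ i) ^ₖ (q ℕ.^ i)) ^ₖ ν i)
         K.≈ mk numerator denominator (regular-∏ n λ i → regular-^ (ε i) (L-regular (n ∸ i)))
    ∏S = KReasoning.begin
      ∏ₖ n (λ i → (S (n ∸ i) ^ₖ (q ℕ.^ i)) ^ₖ ν i) K.* (S (n ∸ n) ^ₖ (q ℕ.^ n)) ^ₖ ν n
        KReasoning.≈⟨ K.*-cong (∏ₖ-cong n λ i _ → factor i) last ⟩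
      ∏ₖ n (λ i → mk (((- 1#) ^ (n ∸ i) * P (n ∸ i)) ^ ε i) (L (n ∸ i) ^ ε i) (regular-^ (ε i) (L-regular (n ∸ i)))) K.* K.1#
        KReasoning.≈⟨ K.*-identityʳ _ ⟩
      ∏ₖ n (λ i → mk (((- 1#) ^ (n ∸ i) * P (n ∸ i)) ^ ε i) (L (n ∸ i) ^ ε i) (regular-^ (ε i) (L-regular (n ∸ i))))
        KReasoning.≈⟨ mk-∏ n (λ i → regular-^ (ε i) (L-regular (n ∸ i))) ⟩
      mk (∏ n (λ i → ((- 1#) ^ (n ∸ i) * P (n ∸ i)) ^ ε i)) denominator (regular-∏ n λ i → regular-^ (ε i) (L-regular (n ∸ i)))
        KReasoning.≈⟨ by (*-congʳ numerator-∏) ⟩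
      mk numerator denominator (regular-∏ n λ i → regular-^ (ε i) (L-regular (n ∸ i))) KReasoning.∎
      where
      open RingFacts fractionRing using () renaming (1^n≈1 to 1^ₖn≈1)

      merge : ∀ x i → (x ^ₖ (q ℕ.^ i)) ^ₖ ν i K.≈ x ^ₖ ε i
      merge x i = K.trans (^ₖ-assocʳ x (q ℕ.^ i) (ν i)) (^ₖ-congʳ x (ℕ.*-comm (q ℕ.^ i) (ν i)))

      factor : ∀ i → (S (n ∸ i) ^ₖ (q ℕ.^ i)) ^ₖ ν i
        K.≈ mk (((- 1#) ^ (n ∸ i) * P (n ∸ i)) ^ ε i) (L (n ∸ i) ^ ε i) (regular-^ (ε i) (L-regular (n ∸ i)))
      factor i = K.trans (merge (S (n ∸ i)) i) (mk-^ (L-regular (n ∸ i)) (ε i))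

      -- The factor at `i = n` is a power of `S 0 = 1`; without it the product has the range of the
      -- statement.
      last : (S (n ∸ n) ^ₖ (q ℕ.^ n)) ^ₖ ν n K.≈ K.1#
      last = KReasoning.begin
        (S (n ∸ n) ^ₖ (q ℕ.^ n)) ^ₖ ν n   KReasoning.≈⟨ merge (S (n ∸ n)) n ⟩
        S (n ∸ n) ^ₖ ε n                  KReasoning.≡⟨ ≡.cong (λ m → S m ^ₖ ε n) (ℕ.n∸n≡0 n) ⟩
        S 0 ^ₖ ε n                        KReasoning.≈⟨ ^ₖ-congˡ (ε n) S-zero ⟩
        K.1# ^ₖ ε n                       KReasoning.≈⟨ 1^ₖn≈1 (ε n) ⟩
        K.1#                              KReasoning.∎

  -- Here `γ` is the factor `Γ_m` that `H` multiplies in and the quotient divides out again. It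
  -- lands on both sides of the cross-multiplied equation.
  clear-common-factor : ∀ γ u v p r → u * r ≈ p * v → γ * u * 1# * r ≈ p * (1# * v * γ)
  clear-common-factor γ u v p r ur≈pv = begin
    γ * u * 1# * r       ≈⟨ solve 3 (λ γ u r → γ :* u :* con 1 :* r := u :* r :* γ) refl γ u r ⟩
    u * r * γ            ≈⟨ *-congʳ ur≈pv ⟩
    p * v * γ            ≈⟨ solve 3 (λ p v γ → p :* v :* γ := p :* (con 1 :* v :* γ)) refl p v γ ⟩
    p * (1# * v * γ)     ∎

  module Coefficients (n N : ℕ) (N+1≡q^n : suc N ≡ q ℕ.^ suc n) where
    open InverseCoefficients expLog n N N+1≡q^n using (F; F-recursion; F-value)
    open SeriesFacts fractionRing using (X; _^ₛ_; X^-shift; X^-⊛-vanish) renaming (_⊛_ to _⊛ₛ_)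
    open BigOperator K.+-commutativeMonoid using () renaming (fold to ∑ₖ)

    coefficient : ℕ → Fraction
    coefficient = F

    term : ℕ → ℕ → Fraction
    term k i = a i K.* (X ^ₛ (q ℕ.^ i) ⊛ₛ F) k

    represents-coefficient-0 : Represents (1# , 1#) (coefficient 0)
    represents-coefficient-0 = represents-≈ (K.sym (K.trans (F-recursion 0 z≤n) (K.trans
      (K.+-congˡ (K.trans (K.+-identityˡ _) (K.trans (K.*-congˡ (X^-⊛-vanish 1 F 0 (s≤s z≤n))) (K.zeroʳ _))))
      (K.+-identityʳ _)))) represents-1

    represents-coefficient-suc : ∀ k → suc k ≤ N → ∀ uv →
      Represents uv (∑ₖ (suc (suc k)) (term (suc k))) → Represents uv (coefficient (suc k))
    represents-coefficient-suc k k<N uv =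
      represents-≈ (K.trans (K.sym (K.+-identityˡ _)) (K.sym (F-recursion (suc k) k<N)))

    represents-term-0 : ∀ k i → k < q ℕ.^ i → Represents (0# , 1#) (term k i)
    represents-term-0 k i k<q^i = represents-≈
      (K.sym (K.trans (K.*-congˡ (X^-⊛-vanish (q ℕ.^ i) F k k<q^i)) (K.zeroʳ _))) represents-0

    represents-term : ∀ k i → q ℕ.^ i ≤ k → ∀ u v u′ v′ → Represents (u , v) (a i) →
      Represents (u′ , v′) (coefficient (k ∸ q ℕ.^ i)) → Represents (u * u′ , v * v′) (term k i)
    represents-term k i q^i≤k u v u′ v′ p p′ = represents-≈
      (K.*-congˡ (K.trans (K.sym (X^-shift (q ℕ.^ i) F (k ∸ q ℕ.^ i)))
        (K.reflexive (≡.cong (X ^ₛ (q ℕ.^ i) ⊛ₛ F) (ℕ.m+[n∸m]≡n q^i≤k)))))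
      (represents-* p p′)

    formula : ∀ ν → sumℕ (suc n) ν < q → ∀ u v →
      Represents (u , v) (coefficient (N ∸ sumℕ (suc n) (ε n ν))) →
      u * denominator n ν ≈ numerator n ν * v
    formula ν ∑ν<q u v (r , p) = cross (K.trans p (K.trans (F-value ν ∑ν<q) (∏S n ν)))

-- The ring F_q[[θ,t]]

open import Data.Nat.Base using (_+_; _*_; _^_)

module SerRing {c ℓ q} (𝔽 : FiniteField c ℓ q) where
  private module F = FiniteField 𝔽
  open Construction 𝔽
  private
    module Sₜ = SeriesFacts F.commRing
    module Sθ = SeriesFacts Sₜ.seriesRing
  open BigOperator F.+-commutativeMonoid using () renaming (fold to ∑; fold-cong to ∑-cong)
  open BigOperator (CommutativeRing.+-commutativeMonoid Sₜ.seriesRing) using () renaming (fold to ∑ₜ)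

  sumF≡∑ : ∀ n f → sumF n f ≡ ∑ n f
  sumF≡∑ zero    f = ≡.refl
  sumF≡∑ (suc n) f = ≡.cong (F._+ f n) (sumF≡∑ n f)

  *s≋⊛ : ∀ f g → f *s g ≋ (f Sθ.⊛ g)
  *s≋⊛ f g a b = begin
    sumF (suc a) (λ i → sumF (suc b) (λ j → f i j F.* g (a ∸ i) (b ∸ j)))
      ≡⟨ sumF≡∑ (suc a) _ ⟩
    ∑ (suc a) (λ i → sumF (suc b) (λ j → f i j F.* g (a ∸ i) (b ∸ j)))
      ≈⟨ ∑-cong (suc a) (λ i _ → F.trans (F.reflexive (sumF≡∑ (suc b) _)) (F.sym (Sₜ.⊛-as-sum (f i) (g (a ∸ i)) b))) ⟩
    ∑ (suc a) (λ i → (f i Sₜ.⊛ g (a ∸ i)) b)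
      ≡⟨ Sₜ.∑ₛ-coefficient (suc a) _ b ⟨
    ∑ₜ (suc a) (λ i → f i Sₜ.⊛ g (a ∸ i)) b
      ≈⟨ Sθ.⊛-as-sum f g a b ⟨
    (f Sθ.⊛ g) a b ∎
    where open SetoidReasoning F.setoid

  0s≋𝟘 : 0s ≋ Sθ.𝟘
  0s≋𝟘 zero    zero    = F.refl
  0s≋𝟘 zero    (suc b) = F.refl
  0s≋𝟘 (suc a) b       = F.refl

  1s≋𝟙 : 1s ≋ Sθ.𝟙
  1s≋𝟙 zero    zero    = F.refl
  1s≋𝟙 zero    (suc b) = F.refl
  1s≋𝟙 (suc a) b       = F.refl

  serRawRing : RawRing c ℓ
  serRawRing = record
    { Carrier = Ser ; _≈_ = _≋_ ; _+_ = _+s_ ; _*_ = _*s_ ; -_ = -s_ ; 0# = 0s ; 1# = 1s }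

  -- Iterated series, in `θ` over series in `t`, have the same underlying functions as `Ser`. The
  -- identity map thus carries the ring laws over to the double convolution `*s`.
  ser-isMonomorphism : IsRingMonomorphism serRawRing (CommutativeRing.rawRing Sθ.seriesRing) id
  ser-isMonomorphism = record
    { isRingHomomorphism = record
      { isSemiringHomomorphism = record
        { isNearSemiringHomomorphism = record
          { +-isMonoidHomomorphism = record
            { isMagmaHomomorphism = record
              { isRelHomomorphism = record { cong = id }
              ; homo = λ _ _ _ _ → F.refl }
            ; ε-homo = 0s≋𝟘 }
          ; *-homo = *s≋⊛ }
        ; 1#-homo = 1s≋𝟙 }
      ; -‿homo = λ _ _ _ → F.refl }
    ; injective = id }

  serRing : CommutativeRing c ℓ
  serRing = record
    { isCommutativeRing = RingMonomorphism.isCommutativeRing ser-isMonomorphism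
        (CommutativeRing.isCommutativeRing Sθ.seriesRing) }

  private module R = CommutativeRing serRing
  open Exp R.commutativeSemiring using () renaming (_^_ to _^ᵣ_)
  open BigOperator R.*-commutativeMonoid using () renaming (fold to ∏)

  ^s≡^ : ∀ f n → f ^s n ≡ f ^ᵣ n
  ^s≡^ f zero    = ≡.refl
  ^s≡^ f (suc n) = ≡.cong (f *s_) (^s≡^ f n)

  prodS≡∏ : ∀ n {f g} → (∀ i → f i ≡ g i) → prodS n f ≡ ∏ n g
  prodS≡∏ zero    f≡g = ≡.refl
  prodS≡∏ (suc n) f≡g = ≡.cong₂ _*s_ (prodS≡∏ n f≡g) (f≡g n)

  binomialsVanish : BinomialsVanish serRing q
  binomialsVanish k 0<k k<q a b = F.trans (F.reflexive (×-coefficient (q C k))) (at a b)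
    where
    open Mult F.semiring using () renaming (_×_ to _×ₖ_)
    open Mult R.semiring using () renaming (_×_ to _×ᵣ_)

    ×-coefficient : ∀ m → (m ×ᵣ 1s) a b ≡ m ×ₖ 1s a b
    ×-coefficient zero    = lemma a b
      where
      lemma : ∀ a b → 0s a b ≡ F.0#
      lemma zero    zero    = ≡.refl
      lemma zero    (suc _) = ≡.refl
      lemma (suc _) _       = ≡.refl
    ×-coefficient (suc m) = ≡.cong (1s a b F.+_) (×-coefficient m)

    m×0≈0 : ∀ m → m ×ₖ F.0# F.≈ F.0#
    m×0≈0 zero    = F.refl
    m×0≈0 (suc m) = F.trans (F.+-identityˡ _) (m×0≈0 m)

    at : ∀ a b → (q C k) ×ₖ 1s a b F.≈ 0s a b
    at zero    zero    = FiniteFieldProperties.binomial-vanishes 𝔽 k 0<k k<q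
    at zero    (suc _) = m×0≈0 (q C k)
    at (suc _) _       = m×0≈0 (q C k)

  1<q : 1 < q
  1<q = distinct (index F.1#) (index F.0#) λ eq →
    F.1≉0 (F.trans (F.sym (enum-index F.1#)) (F.trans (F.reflexive (≡.cong F.enum eq)) (enum-index F.0#)))
    where
    open FiniteFieldProperties 𝔽 using (index; enum-index)
    distinct : ∀ {m} (i j : Fin m) → i ≢ j → 1 < m
    distinct {suc zero}    zero zero i≢j = ⊥-elim (i≢j ≡.refl)
    distinct {suc (suc m)} _        _        _   = s≤s (s≤s z≤n)

  t≋κX : t ≋ Sθ.κ Sₜ.X
  t≋κX zero    zero          = F.refl
  t≋κX zero    (suc zero)    = F.refl
  t≋κX zero    (suc (suc b)) = F.refl
  t≋κX (suc a) b             = F.refl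

  t^≋κX^ : ∀ m → t ^ᵣ m ≋ Sθ.κ (Sₜ.X Sₜ.^ₛ m)
  t^≋κX^ zero    = R.trans 1s≋𝟙 κ1
    where
    κ1 : Sθ.𝟙 ≋ Sθ.κ Sₜ.𝟙
    κ1 zero    b = F.refl
    κ1 (suc a) b = F.refl
  t^≋κX^ (suc m) a b = begin
    (t *s t ^ᵣ m) a b                             ≈⟨ *s≋⊛ t (t ^ᵣ m) a b ⟩
    (t Sθ.⊛ t ^ᵣ m) a b                           ≈⟨ Sθ.⊛-cong t≋κX (t^≋κX^ m) a b ⟩
    (Sθ.κ Sₜ.X Sθ.⊛ Sθ.κ (Sₜ.X Sₜ.^ₛ m)) a b      ≈⟨ Sθ.κ-⊛ Sₜ.X (Sθ.κ (Sₜ.X Sₜ.^ₛ m)) a b ⟩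
    (Sₜ.X Sₜ.⊛ Sθ.κ (Sₜ.X Sₜ.^ₛ m) a) b           ≈⟨ absorb a b ⟩
    Sθ.κ (Sₜ.X Sₜ.^ₛ suc m) a b                   ∎
    where
    open SetoidReasoning F.setoid
    absorb : ∀ a b → (Sₜ.X Sₜ.⊛ Sθ.κ (Sₜ.X Sₜ.^ₛ m) a) b F.≈ Sθ.κ (Sₜ.X Sₜ.^ₛ suc m) a b
    absorb zero    b = F.refl
    absorb (suc a) b = CommutativeRing.zeroʳ Sₜ.seriesRing Sₜ.X b

  -- The factor is free of `θ`, so it acts on each row `x a` separately as a series in `t`. Its
  -- lowest term `-t` forces the coefficients of the row to vanish one after another.
  t^m-t-regular : ∀ m → 1 < m → Fractions.Regular serRing (t ^ᵣ m -s t)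
  t^m-t-regular m 1<m x xu≈0 a b = F.trans (row-vanishes (suc b) b ℕ.≤-refl) (F.sym (0s≋𝟘 a b))
    where
    open SetoidReasoning F.setoid
    open RingProperties (CommutativeRing.ring F.commRing) using (-‿distribʳ-*)
    open GroupProperties F.+-group using (⁻¹-injective; ε⁻¹≈ε)

    u : Sₜ.Series
    u = (Sₜ.X Sₜ.^ₛ m) Sₜ.⊕ (Sₜ.⊖ Sₜ.X)

    u-vanish : Sₜ.Vanish 1 u
    u-vanish j j<1 = begin
      (Sₜ.X Sₜ.^ₛ m) j F.- Sₜ.X j   ≈⟨ F.+-cong (Sₜ.X^-vanish m j (ℕ.<-trans j<1 1<m)) (F.-‿cong (Sₜ.X-vanish j j<1)) ⟩
      F.0# F.- F.0#                 ≈⟨ F.-‿inverseʳ F.0# ⟩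
      F.0#                          ∎

    u-leading : u 1 F.≈ F.- F.1#
    u-leading = F.trans (F.+-congʳ (Sₜ.X^-vanish m 1 1<m)) (F.+-identityˡ _)

    d≋κu : t ^ᵣ m -s t ≋ Sθ.κ u
    d≋κu a b = F.trans (F.+-cong (t^≋κX^ m a b) (F.-‿cong (t≋κX a b))) (combine a b)
      where
      combine : ∀ a b → Sθ.κ (Sₜ.X Sₜ.^ₛ m) a b F.- Sθ.κ Sₜ.X a b F.≈ Sθ.κ u a b
      combine zero    b = F.refl
      combine (suc a) b = F.-‿inverseʳ F.0#

    row⊛u : ∀ b → (x a Sₜ.⊛ u) b F.≈ F.0#
    row⊛u b = begin
      (x a Sₜ.⊛ u) b               ≈⟨ Sₜ.⊛-comm (x a) u b ⟩
      (u Sₜ.⊛ x a) b               ≈⟨ Sθ.κ-⊛ u x a b ⟨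
      (Sθ.κ u Sθ.⊛ x) a b          ≈⟨ Sθ.⊛-comm (Sθ.κ u) x a b ⟩
      (x Sθ.⊛ Sθ.κ u) a b          ≈⟨ Sθ.⊛-cong {x} (λ _ _ → F.refl) d≋κu a b ⟨
      (x Sθ.⊛ (t ^ᵣ m -s t)) a b   ≈⟨ *s≋⊛ x (t ^ᵣ m -s t) a b ⟨
      (x *s (t ^ᵣ m -s t)) a b     ≈⟨ xu≈0 a b ⟩
      0s a b                       ≈⟨ 0s≋𝟘 a b ⟩
      F.0#                         ∎

    next : ∀ p → Sₜ.Vanish p (x a) → x a p F.≈ F.0#
    next p v = ⁻¹-injective (begin
      F.- x a p              ≈⟨ F.-‿cong (F.*-identityʳ _) ⟨
      F.- (x a p F.* F.1#)   ≈⟨ -‿distribʳ-* _ _ ⟩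
      x a p F.* F.- F.1#     ≈⟨ F.*-congˡ u-leading ⟨
      x a p F.* u 1          ≈⟨ Sₜ.leading-⊛ p 1 v u-vanish ⟨
      (x a Sₜ.⊛ u) (p + 1)   ≈⟨ row⊛u (p + 1) ⟩
      F.0#                   ≈⟨ ε⁻¹≈ε ⟨
      F.- F.0#               ∎)

    row-vanishes : ∀ p → Sₜ.Vanish p (x a)
    row-vanishes (suc p) j (s≤s j≤p) with ℕ.m≤n⇒m<n∨m≡n j≤p
    ... | inj₁ j<p    = row-vanishes p j j<p
    ... | inj₂ ≡.refl = next p (row-vanishes p)

  1<q^ : ∀ k → 1 < q ^ suc k
  1<q^ k = ℕ.<-≤-trans 1<q (ℕ.m≤m*n q (q ^ k) {{ℕ.m^n≢0 q k}})

  module AT = AndersonThakur serRing q 1<q binomialsVanish t θ (λ k → t^m-t-regular (q ^ suc k) (1<q^ k))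

  brk≡ : ∀ k → brk t k ≡ t ^ᵣ (q ^ k) -s t
  brk≡ k = ≡.cong (_-s t) (^s≡^ t (q ^ k))

  L≡ : ∀ k → L t k ≡ AT.L k
  L≡ k = prodS≡∏ k λ j → brk≡ (suc j)

  D≡ : ∀ k → D t k ≡ AT.D k
  D≡ k = prodS≡∏ k λ i → ≡.cong₂ _-s_ (^s≡^ t (q ^ k)) (^s≡^ t (q ^ i))

  G≡ : ∀ i → G i ≡ AT.G i
  G≡ i = prodS≡∏ i λ j → ≡.cong₂ _-s_ (^s≡^ t (q ^ i)) (^s≡^ θ (q ^ suc j))

  open AT using (Represents)
  open BigOperator (CommutativeRing.+-commutativeMonoid (Fractions.fractionRing serRing)) using ()
    renaming (fold to ∑ₖ)

  represents-a : ∀ i → Represents (a i) (AT.a i)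
  represents-a i = ≡.subst (λ uv → Represents uv (AT.a i))
    (≡.sym (≡.cong₂ _,_ (G≡ i) (D≡ i))) (AT.represents-a i)

  represents-sumFrac : ∀ n {f κ} → (∀ i → Represents (f i) (κ i)) → Represents (sumFrac n f) (∑ₖ n κ)
  represents-sumFrac zero    p = AT.represents-0
  represents-sumFrac (suc n) {f} {κ} p = AT.represents-+
    {proj₁ (sumFrac n f)} {proj₂ (sumFrac n f)} {proj₁ (f n)} {proj₂ (f n)} {∑ₖ n κ} {κ n}
    (represents-sumFrac n p) (p n)

  -- Names the summand of cAux, which is local to its definition.
  summand : ∀ {m g} (x : Frac) → x ≡ sumFrac m g → ℕ → Frac
  summand {g = g} _ _ = g

  -- Abstracting the decision `q ^ i ≤? suc k` makes the local summand of `cAux` reduce in both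
  -- branches; `P` is kept general so that the summand itself is never spelled out.
  summand-elim : ∀ {p} (P : Frac → Set p) f k i →
    (q ^ i ≤ suc k → P (a i ·f cAux f (suc k ∸ q ^ i))) → (suc k < q ^ i → P 0f) →
    P (summand {suc (suc k)} (cAux (suc f) (suc k)) ≡.refl i)
  summand-elim P f k i small large with q ^ i ℕ.≤? suc k
  ... | yes q^i≤1+k = small q^i≤1+k
  ... | no  q^i≰1+k = large (ℕ.≰⇒> q^i≰1+k)

  module _ (n N : ℕ) (N+1≡q^n : suc N ≡ q ^ suc n) where
    open AT.Coefficients n N N+1≡q^n

    -- Induction on the fuel: `q^i ≥ 1` makes the index drop in each call. The bound `k ≤ N` stays
    -- because the truncated `F` satisfies the recursion only up to `N`.
    represents-cAux : ∀ f k → k < f → k ≤ N → Represents (cAux f k) (coefficient k)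
    represents-cAux (suc f) zero    _         _   = represents-coefficient-0
    represents-cAux (suc f) (suc k) (s≤s k<f) k≤N =
      represents-coefficient-suc k k≤N (cAux (suc f) (suc k))
        (represents-sumFrac (suc (suc k)) {summand {suc (suc k)} (cAux (suc f) (suc k)) ≡.refl} {term (suc k)} λ i →
          summand-elim (λ uv → Represents uv (term (suc k) i)) f k i (small i) (represents-term-0 (suc k) i))
      where
      small : ∀ i → q ^ i ≤ suc k → Represents (a i ·f cAux f (suc k ∸ q ^ i)) (term (suc k) i)
      small i q^i≤1+k = represents-term (suc k) i q^i≤1+k _ _
        (proj₁ (cAux f (suc k ∸ q ^ i))) (proj₂ (cAux f (suc k ∸ q ^ i)))
        (represents-a i) (represents-cAux f (suc k ∸ q ^ i)
          (ℕ.<-≤-trans (ℕ.∸-monoʳ-< {suc k} {q ^ i} {0} (ℕ.m^n>0 q i) q^i≤1+k) k<f)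
          (ℕ.≤-trans (ℕ.m∸n≤m (suc k) (q ^ i)) k≤N))

  module _ (n : ℕ) (ν : ℕ → ℕ) where
    numerator≡ : (-s 1s) ^s sumℕ n (λ i → (n ∸ i) * ν i * q ^ i)
                 *s prodS n (λ k → (t -s θ ^s (q ^ (k + 1))) ^s sumℕ (suc n ∸ (k + 1)) (λ j → ν j * q ^ j))
                 ≡ AT.numerator n ν
    numerator≡ = ≡.cong₂ _*s_ (^s≡^ (-s 1s) (sumℕ n λ i → (n ∸ i) * ν i * q ^ i)) (prodS≡∏ n λ k →
      ≡.trans (^s≡^ (t -s θ ^s (q ^ (k + 1))) (sumℕ (suc n ∸ (k + 1)) (AT.ε n ν)))
              (≡.cong (λ z → (t -s z) ^ᵣ sumℕ (suc n ∸ (k + 1)) (AT.ε n ν)) (^s≡^ θ (q ^ (k + 1)))))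

    denominator≡ : prodS n (λ i → L t (n ∸ i) ^s (ν i * q ^ i)) ≡ AT.denominator n ν
    denominator≡ = prodS≡∏ n λ i →
      ≡.trans (^s≡^ (L t (n ∸ i)) (AT.ε n ν i)) (≡.cong (_^ᵣ AT.ε n ν i) (L≡ (n ∸ i)))

theorem3p2 : ∀ {c ℓ} (q : ℕ) (𝔽 : FiniteField c ℓ q) (n : ℕ) → 1 ≤ n →
  (N : ℕ → ℕ) → sumℕ n N ≤ q ∸ 1 →
  let open Construction 𝔽
      m = q ^ n ∸ sumℕ n (λ i → N i * q ^ i)
  in  H (m ∸ 1) ÷ ⟦ Γ₊₁ t (m ∸ 1) ⟧
      ≃ ( (-s 1s) ^s sumℕ (n ∸ 1) (λ i → (n ∸ 1 ∸ i) * N i * q ^ i)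
            *s prodS (n ∸ 1) (λ k → (t -s θ ^s (q ^ (k + 1)))
                                      ^s sumℕ (n ∸ (k + 1)) (λ j → N j * q ^ j))
        , prodS (n ∸ 1) (λ i → L t (n ∸ 1 ∸ i) ^s (N i * q ^ i)) )
theorem3p2 q 𝔽 (suc n) _ N ∑N≤q-1 =
  ≡.subst₂ (λ x y → H M ÷ ⟦ Γ₊₁ t M ⟧ ≃ (x , y)) (≡.sym (numerator≡ n N)) (≡.sym (denominator≡ n N))
    (AT.clear-common-factor (Γ₊₁ t M) (proj₁ (invCoeff M)) (proj₂ (invCoeff M)) (AT.numerator n N) (AT.denominator n N)
      (formula N ∑N<q (proj₁ (invCoeff M)) (proj₂ (invCoeff M))
        (≡.subst (λ k → AT.Represents (invCoeff M) (coefficient k)) M≡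
          (represents-cAux n (ℕ.pred (q ^ suc n)) N+1≡ (suc M) M ℕ.≤-refl
            (≡.subst (_≤ ℕ.pred (q ^ suc n)) (≡.sym M≡) (ℕ.m∸n≤m (ℕ.pred (q ^ suc n)) total))))))
  where
  open Construction 𝔽
  open SerRing 𝔽
  total = sumℕ (suc n) (λ i → N i * q ^ i)
  M = q ^ suc n ∸ total ∸ 1

  N+1≡ : suc (ℕ.pred (q ^ suc n)) ≡ q ^ suc n
  N+1≡ = ℕ.suc-pred (q ^ suc n) {{ℕ.m^n≢0 q (suc n)}}

  open AT.Coefficients n (ℕ.pred (q ^ suc n)) N+1≡ using (coefficient; formula)

  -- Brings `m - 1` into the form `N - total` at which `formula` reads off the coefficient, with
  -- `N = q^(n+1) - 1`.
  M≡ : M ≡ ℕ.pred (q ^ suc n) ∸ total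
  M≡ = ≡.trans (ℕ.∸-+-assoc (q ^ suc n) total 1) (≡.trans (≡.cong (q ^ suc n ∸_) (ℕ.+-comm total 1))
    (≡.cong (_∸ suc total) (≡.sym N+1≡)))

  ∑N<q : sumℕ (suc n) N < q
  ∑N<q = ℕ.≤-<-trans ∑N≤q-1 (ℕ.∸-monoʳ-< {q} {1} {0} (s≤s z≤n) (ℕ.<⇒≤ 1<q))
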